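{- Let $k \ge 1$ and $d > h \ge 2$ be positive integers and let $G = (U,V,E)$ be a bipartite graph. Suppose that $d(u) \le d$ for all $u \in U$ and, for all $S \subseteq U$, $$|\Gamma(S)| \ge \left(h-1+\frac{d-h+1}{k+1+(d-h-1)\lceil k/h \rceil}\right)|S|.$$ Then $G$ has an $(h,hk)$-matching.
   Context: All graphs are finite and simple. $G=(U,V,E)$ denotes a bipartite graph with left vertex class $U$, right vertex class $V$ and edge set $E$; $d(u)$ is the degree of the vertex $u$ in $G$. For a set $S$ of vertices, $\Gamma(S)$ denotes the set of vertices adjacent to at least one vertex of $S$. For positive integers $t \ge s$, an $(s,t)$-matching in $G=(U,V,E)$ is a subset $F \subseteq E$ such that, in the graph $H=(U,V,F)$, each connected component is a tree with at most $t$ edges, and every $u \in U$ has degree $d_H(u)=s$. -}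

module Defs where

open import Data.Bool.Base using (if_then_else_)
open import Data.Empty using (⊥)
open import Data.Fin.Base using (Fin)
open import Data.Fin.Properties using (any?)
open import Data.Fin.Subset using (Subset; _∈_; _⊆_; _∩_; ∣_∣) renaming (⊥ to ∅)
open import Data.Fin.Subset.Properties using (_∈?_)
open import Data.Integer.Base as ℤ using (+_)
open import Data.List.Base using (List; []; _∷_; length; _∷ʳ_)
open import Data.List.Relation.Unary.Linked using (Linked)
open import Data.List.Relation.Unary.Unique.Propositional using (Unique)
open import Data.Nat.Base using (ℕ; suc; _+_; _*_; _∸_; _≤_; NonZero)
open import Data.Product.Base using (_×_; _,_; ∃; ∃-syntax)
open import Data.Rational.Unnormalised.Base as ℚᵘ using (ℚᵘ; _/_)
open import Data.Sum.Base using (_⊎_; inj₁; inj₂)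
open import Data.Vec.Base using (sum; tabulate)
open import Function.Bundles using (_⇔_)
open import Level using (0ℓ)
open import Relation.Binary.Construct.Closure.ReflexiveTransitive using (Star)
open import Relation.Binary.Core using (Rel)
open import Relation.Binary.PropositionalEquality.Core using (_≡_)
open import Relation.Nullary.Decidable using (does; _×-dec_)
open import Relation.Nullary.Negation using (¬_)

-- A bipartite graph with left class U = Fin m and right class V = Fin n, given
-- by its edge set: G u is the set of v with uv ∈ E.  Spanning subgraphs
-- (U , V , F) are therefore values of the same type.
BipartiteGraph : ℕ → ℕ → Set
BipartiteGraph m n = Fin m → Subset n

Vertex : ℕ → ℕ → Set
Vertex m n = Fin m ⊎ Fin n

VertexSet : ℕ → ℕ → Set
VertexSet m n = Subset m × Subset n

private
  variable
    m n : ℕ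

infix 4 _∈ᵛ_

_∈ᵛ_ : Vertex m n → VertexSet m n → Set
inj₁ u ∈ᵛ (A , _) = u ∈ A
inj₂ v ∈ᵛ (_ , B) = v ∈ B

Adjacent : BipartiteGraph m n → Rel (Vertex m n) 0ℓ
Adjacent G (inj₁ u) (inj₂ v) = v ∈ G u
Adjacent G (inj₂ v) (inj₁ u) = v ∈ G u
Adjacent G (inj₁ _) (inj₁ _) = ⊥
Adjacent G (inj₂ _) (inj₂ _) = ⊥

degree : BipartiteGraph m n → Fin m → ℕ
degree G u = ∣ G u ∣

edgeCount : BipartiteGraph m n → ℕ
edgeCount G = sum (tabulate (degree G))

-- Γ(S) for S ⊆ U; all neighbours of such an S lie in V.
Γ : BipartiteGraph m n → Subset m → Subset n
Γ G S = tabulate λ v → does (any? λ u → (u ∈? S) ×-dec (v ∈? G u))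

-- The subgraph induced on C, as an edge set: vertices outside C remain in the
-- type but become isolated, so its vertex set C has to be carried alongside.
induced : BipartiteGraph m n → VertexSet m n → BipartiteGraph m n
induced G (A , B) u = if does (u ∈? A) then G u ∩ B else ∅

-- x₁ … xₗ (without repeating x₁ at the end) are the vertices of a cycle.
IsCycle : BipartiteGraph m n → List (Vertex m n) → Set
IsCycle G []       = ⊥
IsCycle G (x ∷ xs) =
  3 ≤ length (x ∷ xs) × Unique (x ∷ xs) × Linked (Adjacent G) ((x ∷ xs) ∷ʳ x)

-- The graph with vertex set C and the edges of T is a tree; used only when all
-- edges of T lie inside C.
record IsTree (C : VertexSet m n) (T : BipartiteGraph m n) : Set where
  field
    nonempty  : ∃[ x ] x ∈ᵛ C
    connected : ∀ x y → x ∈ᵛ C → y ∈ᵛ C → Star (Adjacent T) x y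
    acyclic   : ∀ xs → ¬ IsCycle T xs

IsComponent : BipartiteGraph m n → VertexSet m n → Set
IsComponent G C = ∃[ x ] (∀ y → y ∈ᵛ C ⇔ Star (Adjacent G) x y)

record IsMatching (s t : ℕ) (G F : BipartiteGraph m n) : Set where
  field
    F⊆E             : ∀ u → F u ⊆ G u
    components-tree : ∀ C → IsComponent F C → IsTree C (induced F C)
    components-size : ∀ C → IsComponent F C → edgeCount (induced F C) ≤ t
    left-degree     : ∀ u → degree F u ≡ s

HasMatching : (s t : ℕ) → BipartiteGraph m n → Set
HasMatching s t G = ∃[ F ] IsMatching s t G F

fromℕ : ℕ → ℚᵘ
fromℕ a = + a / 1

-- ∣_∣ only converts the nonnegative integer ⌈k/h⌉ to ℕ.
⌈_÷_⌉ : (k h : ℕ) .{{_ : NonZero h}} → ℕ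
⌈ k ÷ h ⌉ = ℤ.∣ ℚᵘ.ceiling (+ k / h) ∣

-- h - 1 + (d - h + 1) / (k + 1 + (d - h - 1) ⌈k/h⌉); for d > h ≥ 1 none of the
-- subtractions truncates.
expansion : (k d h : ℕ) .{{_ : NonZero h}} → ℚᵘ
expansion k d h =
  fromℕ (h ∸ 1) ℚᵘ.+ + (d ∸ h + 1) / (suc k + (d ∸ h ∸ 1) * ⌈ k ÷ h ⌉)

module Submission where

-- Left vertices u are added one at a time to a forest in which every left vertex
-- added so far has degree h and every tree has at most k left vertices.  Starting
-- from u, explore the trees reached along edges of G outside the forest, each
-- rooted at the vertex through which it was entered.  If a tree W was entered from
-- a left vertex x of the tree C, one may either cut off the subtree at x and hang
-- it below the root of W, or replace one of the subtrees below x by W; whenever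
-- one of these keeps all trees within bounds and shrinks C, do it, and forget all
-- trees reached after C.  The sequence of sizes decreases lexicographically, so
-- this stops.  If then the h smallest trees entered from u have fewer than k left
-- vertices together, u joins them.  Otherwise put q = ⌈k/h⌉, E = d - h + 1,
-- B = k + 1 + (d - h - 1) q, and call a tree short if it has fewer than B / E left
-- vertices.  In each tree C at most one left vertex x has short children; their
-- number is at most d - h, their sizes are at least q, and the size of C plus
-- that of any of them exceeds k, so that C compensates for all of them.  Hence
-- the explored trees are on average too large, and their left vertices together
-- with u violate the expansion hypothesis.

open import Data.Nat.Properties using (+-0-commutativeMonoid; +-*-semiring)
open import Algebra.Properties.Semiring.Sum +-*-semiring using (*-distribˡ-sum)
open import Algebra.Properties.CommutativeMonoid.Sum +-0-commutativeMonoid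
  using (∑-distrib-+; sum-cong-≗) renaming (sum to ∑)
open import Data.Bool.Base using (if_then_else_)
open import Data.Empty using (⊥; ⊥-elim)
open import Data.Fin.Base using (Fin; zero; suc)
open import Data.Fin.Properties using (_≟_; any?)
open import Data.Fin.Subset using (Subset; _∈_; ∣_∣; inside; outside)
open import Data.Fin.Subset.Properties using (_∈?_; x∈p∩q⁺; x∈p∩q⁻; ∣⊥∣≡0; ∣p∩q∣≤∣p∣; ∉⊥)
open import Data.Integer.Base as ℤ using (+_)
import Data.Integer.Properties as ℤ
open import Data.List.Base using (List; []; _∷_; _++_; map; length; _∷ʳ_; tabulate; allFin; concatMap)
open import Data.List.Properties using (map-++; length-++; length-map)
open import Data.List.Membership.Propositional using (find; lose) renaming (_∈_ to _∈ˡ_)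
open import Data.List.Membership.Propositional.Properties
  using (∈-allFin; ∈-map⁺; ∈-++⁺ˡ; ∈-++⁺ʳ; ∈-++⁻; ∈-concatMap⁺; ∈-concatMap⁻)
open import Data.List.Relation.Binary.Permutation.Propositional using (_↭_; prep; swap; ↭-refl; ↭-sym; ↭-trans)
open import Data.List.Relation.Binary.Permutation.Propositional.Properties using (All-resp-↭; ↭-length; map⁺)
open import Data.List.Relation.Unary.All as All using (All; []; _∷_)
open import Data.List.Relation.Unary.All.Properties using (++⁺; ++⁻ʳ)
open import Data.List.Relation.Unary.Any using (here; there)
open import Data.List.Relation.Unary.AllPairs using ([]; _∷_)
open import Data.List.Relation.Unary.Linked as Linked using (Linked; []; [-]; _∷_)
open import Data.List.Relation.Unary.Unique.Propositional using (Unique)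
open import Data.List.Relation.Unary.Unique.Propositional.Properties using (allFin⁺)
open import Data.Nat.Base using (ℕ; ⌊_/2⌋; ⌈_/2⌉; zero; suc; _+_; _*_; _∸_; _^_; _≤_; _<_; _≥_; z≤n; s≤s; NonZero)
open import Data.Nat.Induction using (Acc; acc; <-wellFounded)
open import Data.Nat.ListAction using (sum)
open import Data.Nat.ListAction.Properties using (sum-++; sum-↭)
open import Data.Nat.Properties renaming (_≟_ to _≟ℕ_)
import Data.Nat.Base as ℕ
open import Data.Nat.DivMod using (m≡m%n+[m/n]*n)
open import Data.Nat.Tactic.RingSolver using (solve-∀)
open import Data.Product.Base using (Σ; Σ-syntax; _×_; _,_; proj₁; proj₂; ∃-syntax)
open import Data.Rational.Unnormalised.Base as ℚᵘ using (ℚᵘ)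
open import Data.Rational.Unnormalised.Properties using (drop-*≤*)
open import Data.Sum.Base using (_⊎_; inj₁; inj₂)
open import Data.Sum.Properties using (≡-dec)
open import Data.Unit.Base using (⊤; tt)
open import Data.Vec.Base as Vec using ([]; _∷_)
open import Data.Vec.Properties using (lookup∘tabulate; lookup⇒[]=; []=⇒lookup)
open import Function.Base using (_∘_)
open import Function.Bundles using (module Equivalence)
open import Relation.Binary.Construct.Closure.ReflexiveTransitive as Star using (Star; ε; _◅_; _◅◅_)
open import Relation.Binary.PropositionalEquality
  using (module ≡-Reasoning; _≡_; _≢_; refl; sym; trans; cong; cong₂; subst; subst₂)
open import Relation.Nullary.Decidable using (Dec; yes; no; does; _×-dec_; _⊎-dec_; dec-true)
open import Relation.Nullary.Negation using (¬_; contradiction)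
open import Defs

-- The constants come from the final count. A tree with s left vertices has 1 + (h - 1) s right
-- vertices. If no edge of G leaves L explored trees with N left vertices in all, then these left
-- vertices and u have at most L + (h - 1) N neighbours, and the hypothesis for N + 1 left vertices
-- becomes B L ≥ E N + E + (h - 1) B. As B L - E N is the sum of B - E s over the explored trees, a
-- contradiction follows once the short trees lack at most (h - 1) B more than the other trees have
-- in excess. The amount (h - 1) B is what the short trees entered from u may lack together when u
-- cannot be attached; every other short tree is charged to the tree that contains its parent. The
-- danger is that one tree is charged for several left vertices at once, and the exchange moves
-- exist to exclude this. Disjointness of trees is never stated as such. Every rearrangement is
-- accompanied by an equation between total weights for an arbitrary weight f on the vertices;
-- special choices of f turn it into statements about sizes, multiplicities or degrees.

private
  variable
    A : Set

-- Indicators, finite sums and weights of lists.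

indicator : ∀ {P : Set} → Dec P → ℕ
indicator P? = if does P? then 1 else 0

indicator-yes : ∀ {P : Set} (P? : Dec P) → P → indicator P? ≡ 1
indicator-yes (yes _) _ = refl
indicator-yes (no ¬p) p = contradiction p ¬p

indicator-no : ∀ {P : Set} (P? : Dec P) → ¬ P → indicator P? ≡ 0
indicator-no (yes p) ¬p = contradiction p ¬p
indicator-no (no _)  _  = refl

indicator-positive : ∀ {P : Set} (P? : Dec P) → 1 ≤ indicator P? → P
indicator-positive (yes p) _ = p

indicator-mono : ∀ {P : Set} (P? : Dec P) {c} → (P → 1 ≤ c) → indicator P? ≤ c
indicator-mono (yes p) f = f p
indicator-mono (no _)  _ = z≤n

+-positive : ∀ a {b} → 1 ≤ a + b → 1 ≤ a ⊎ 1 ≤ b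
+-positive zero    p = inj₂ p
+-positive (suc a) _ = inj₁ (s≤s z≤n)

∑-mono : ∀ {n} {f g : Fin n → ℕ} → (∀ i → f i ≤ g i) → ∑ f ≤ ∑ g
∑-mono {zero}  f≤g = z≤n
∑-mono {suc n} f≤g = +-mono-≤ (f≤g zero) (∑-mono (f≤g ∘ suc))

∑-const : ∀ n c → ∑ {n} (λ _ → c) ≡ n * c
∑-const zero    c = refl
∑-const (suc n) c = cong (_+_ c) (∑-const n c)

∑-indicator : ∀ {n} (a : Fin n) → ∑ (λ i → indicator (i ≟ a)) ≡ 1
∑-indicator {suc n} zero    = cong suc (trans (∑-const n 0) (*-zeroʳ n))
∑-indicator {suc n} (suc a) = ∑-indicator a

∣∣≡∑ : ∀ {n} (S : Subset n) → ∣ S ∣ ≡ ∑ (λ i → indicator (i ∈? S))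
∣∣≡∑ []            = refl
∣∣≡∑ (inside ∷ S)  = cong suc (∣∣≡∑ S)
∣∣≡∑ (outside ∷ S) = ∣∣≡∑ S

weight : (A → ℕ) → List A → ℕ
weight f xs = sum (map f xs)

weight-++ : ∀ (f : A → ℕ) xs ys → weight f (xs ++ ys) ≡ weight f xs + weight f ys
weight-++ f xs ys = trans (cong sum (map-++ f xs ys)) (sum-++ (map f xs) (map f ys))

weight-cong : ∀ {f g : A → ℕ} → (∀ x → f x ≡ g x) → ∀ xs → weight f xs ≡ weight g xs
weight-cong f≡g []       = refl
weight-cong f≡g (x ∷ xs) = cong₂ _+_ (f≡g x) (weight-cong f≡g xs)

weight-+ : ∀ (f g : A → ℕ) xs → weight (λ x → f x + g x) xs ≡ weight f xs + weight g xs
weight-+ f g []       = refl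
weight-+ f g (x ∷ xs) =
  trans (cong (_+_ (f x + g x)) (weight-+ f g xs)) (rearrange (f x) (g x) _ _)
  where
  rearrange : ∀ a b c d → a + b + (c + d) ≡ a + c + (b + d)
  rearrange = solve-∀

weight-* : ∀ c (f : A → ℕ) xs → weight (λ x → c * f x) xs ≡ c * weight f xs
weight-* c f []       = sym (*-zeroʳ c)
weight-* c f (x ∷ xs) = trans (cong (_+_ (c * f x)) (weight-* c f xs)) (sym (*-distribˡ-+ c (f x) _))

weight-zero : ∀ (xs : List A) → weight (λ _ → 0) xs ≡ 0
weight-zero []       = refl
weight-zero (_ ∷ xs) = weight-zero xs

weight-∑ : ∀ {n} (f : Fin n → A → ℕ) xs →
           weight (λ x → ∑ (λ i → f i x)) xs ≡ ∑ (λ i → weight (f i) xs)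
weight-∑ {n = n} f []       = sym (trans (∑-const n 0) (*-zeroʳ n))
weight-∑ f (x ∷ xs) =
  trans (cong (_+_ (∑ (λ i → f i x))) (weight-∑ f xs)) (sym (∑-distrib-+ (λ i → f i x) _))

weight-positive : ∀ (f : A → ℕ) xs → 1 ≤ weight f xs → ∃[ x ] (x ∈ˡ xs × 1 ≤ f x)
weight-positive f (x ∷ xs) p with +-positive (f x) p
... | inj₁ q = x , here refl , q
... | inj₂ q = let y , y∈xs , r = weight-positive f xs q in y , there y∈xs , r

weight-∈ : ∀ (f : A → ℕ) {x xs} → x ∈ˡ xs → f x ≤ weight f xs
weight-∈ f {xs = x ∷ xs} (here refl) = m≤m+n (f x) _
weight-∈ f {xs = y ∷ xs} (there x∈xs) = ≤-trans (weight-∈ f x∈xs) (m≤n+m _ (f y))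

module Weights {m n : ℕ} where

  infix 4 _≟ᵛ_

  _≟ᵛ_ : (x y : Vertex m n) → Dec (x ≡ y)
  _≟ᵛ_ = ≡-dec _≟_ _≟_

  δ : Vertex m n → Vertex m n → ℕ
  δ x y = indicator (x ≟ᵛ y)

  leftWeight : (Fin m → ℕ) → Vertex m n → ℕ
  leftWeight f (inj₁ u) = f u
  leftWeight f (inj₂ _) = 0

  rightWeight : (Fin n → ℕ) → Vertex m n → ℕ
  rightWeight f (inj₁ _) = 0
  rightWeight f (inj₂ v) = f v

  onLeft onRight : Vertex m n → ℕ
  onLeft  = leftWeight (λ _ → 1)
  onRight = rightWeight (λ _ → 1)

  δ-refl : ∀ x → δ x x ≡ 1
  δ-refl x = indicator-yes (x ≟ᵛ x) refl

  ∑-δ-left : ∀ y → ∑ (λ u → δ (inj₁ u) y) ≡ onLeft y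
  ∑-δ-left (inj₁ u) = ∑-indicator u
  ∑-δ-left (inj₂ _) = trans (∑-const m 0) (*-zeroʳ m)

  ∑-δ-right : ∀ y → ∑ (λ v → δ (inj₂ v) y) ≡ onRight y
  ∑-δ-right (inj₁ _) = trans (∑-const n 0) (*-zeroʳ n)
  ∑-δ-right (inj₂ v) = ∑-indicator v

  weight-onLeft : ∀ xs → weight onLeft xs ≡ ∑ (λ u → weight (δ (inj₁ u)) xs)
  weight-onLeft xs =
    trans (sym (weight-cong ∑-δ-left xs)) (weight-∑ (λ u → δ (inj₁ u)) xs)

  weight-onRight : ∀ xs → weight onRight xs ≡ ∑ (λ v → weight (δ (inj₂ v)) xs)
  weight-onRight xs =
    trans (sym (weight-cong ∑-δ-right xs)) (weight-∑ (λ v → δ (inj₂ v)) xs)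

∈-tabulate⁺ : ∀ {n} {P : Fin n → Set} (P? : ∀ i → Dec (P i)) {i} → P i → i ∈ Vec.tabulate (does ∘ P?)
∈-tabulate⁺ P? {i} p = lookup⇒[]= i _ (trans (lookup∘tabulate (does ∘ P?) i) (dec-true (P? i) p))

∈-tabulate⁻ : ∀ {n} {P : Fin n → Set} (P? : ∀ i → Dec (P i)) {i} → i ∈ Vec.tabulate (does ∘ P?) → P i
∈-tabulate⁻ P? {i} i∈ with P? i in eq
... | yes p = p
... | no ¬p = contradiction (trans (sym ([]=⇒lookup i∈)) (trans (lookup∘tabulate (does ∘ P?) i) (cong does eq))) λ ()

unique-count : ∀ {n} (i : Fin n) {xs} → Unique xs → weight (λ x → indicator (i ≟ x)) xs ≤ 1
unique-count i []                       = z≤n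
unique-count i {x ∷ xs} (x∉xs ∷ unique) with i ≟ x
... | no  _    = unique-count i unique
... | yes refl = ≤-reflexive (cong suc (absent x∉xs))
  where
  absent : ∀ {ys} → All (i ≢_) ys → weight (λ y → indicator (i ≟ y)) ys ≡ 0
  absent []                 = refl
  absent {y ∷ _} (i≢y ∷ ps) with i ≟ y
  ... | yes i≡y = contradiction i≡y i≢y
  ... | no  _   = absent ps

term≤∑ : ∀ {n} (f : Fin n → ℕ) i → f i ≤ ∑ f
term≤∑ f zero    = m≤m+n _ _
term≤∑ f (suc i) = ≤-trans (term≤∑ (f ∘ suc) i) (m≤n+m _ (f zero))

-- Rooted trees, rerooting, and degrees inside a tree.

-- A tree in which every left vertex has degree suc h′, rooted at a right vertex:
-- Limbs v are the subtrees below the right vertex v, and Twigs u j are j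
-- subtrees below the left vertex u, whose remaining neighbour is its parent.
module Trees {m n : ℕ} (G : BipartiteGraph m n) (h′ : ℕ) where
  open Weights {m} {n} public

  data Limbs (v : Fin n) : Set
  data Twigs (u : Fin m) : ℕ → Set

  data Limbs v where
    []   : Limbs v
    limb : ∀ u → v ∈ G u → Twigs u h′ → Limbs v → Limbs v

  data Twigs u where
    []   : Twigs u 0
    twig : ∀ {j} v → v ∈ G u → Limbs v → Twigs u j → Twigs u (suc j)

  Tree : Set
  Tree = Σ (Fin n) Limbs

  -- The weight f is kept arbitrary so that one conservation law covers all uses: `onLeft` gives
  -- sizes, `δ x` the multiplicity of x, and a `rightWeight` the number of neighbours of a vertex.
  wtᴸ : (Vertex m n → ℕ) → ∀ {v} → Limbs v → ℕ
  wtᵀ : (Vertex m n → ℕ) → ∀ {u j} → Twigs u j → ℕ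
  wtᴸ f []              = 0
  wtᴸ f (limb u _ ts l) = f (inj₁ u) + (wtᵀ f ts + wtᴸ f l)
  wtᵀ f []              = 0
  wtᵀ f (twig v _ l ts) = f (inj₂ v) + wtᴸ f l + wtᵀ f ts

  wt : (Vertex m n → ℕ) → Tree → ℕ
  wt f (v , l) = f (inj₂ v) + wtᴸ f l

  nodesᴸ : ∀ {v} → Limbs v → List (Vertex m n)
  nodesᵀ : ∀ {u j} → Twigs u j → List (Vertex m n)
  nodesᴸ []              = []
  nodesᴸ (limb u _ ts l) = inj₁ u ∷ (nodesᵀ ts ++ nodesᴸ l)
  nodesᵀ []              = []
  nodesᵀ (twig v _ l ts) = (inj₂ v ∷ nodesᴸ l) ++ nodesᵀ ts

  nodes : Tree → List (Vertex m n)
  nodes (v , l) = inj₂ v ∷ nodesᴸ l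

  weight-nodesᴸ : ∀ f {v} (l : Limbs v) → weight f (nodesᴸ l) ≡ wtᴸ f l
  weight-nodesᵀ : ∀ f {u j} (ts : Twigs u j) → weight f (nodesᵀ ts) ≡ wtᵀ f ts
  weight-nodesᴸ f []              = refl
  weight-nodesᴸ f (limb u _ ts l) = cong (_+_ (f (inj₁ u)))
    (trans (weight-++ f (nodesᵀ ts) (nodesᴸ l)) (cong₂ _+_ (weight-nodesᵀ f ts) (weight-nodesᴸ f l)))
  weight-nodesᵀ f []              = refl
  weight-nodesᵀ f (twig v _ l ts) =
    trans (weight-++ f (inj₂ v ∷ nodesᴸ l) (nodesᵀ ts))
          (cong₂ (λ a b → f (inj₂ v) + a + b) (weight-nodesᴸ f l) (weight-nodesᵀ f ts))

  weight-nodes : ∀ f t → weight f (nodes t) ≡ wt f t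
  weight-nodes f (v , l) = cong (_+_ (f (inj₂ v))) (weight-nodesᴸ f l)

  weight-concat-nodes : ∀ f Φ → weight f (concatMap nodes Φ) ≡ weight (wt f) Φ
  weight-concat-nodes f []      = refl
  weight-concat-nodes f (t ∷ Φ) =
    trans (weight-++ f (nodes t) (concatMap nodes Φ)) (cong₂ _+_ (weight-nodes f t) (weight-concat-nodes f Φ))

  ∑-wt-left : ∀ Φ → ∑ (λ u → weight (wt (δ (inj₁ u))) Φ) ≡ weight (wt onLeft) Φ
  ∑-wt-left Φ = trans (sum-cong-≗ (λ u → sym (weight-concat-nodes (δ (inj₁ u)) Φ)))
    (trans (sym (weight-onLeft (concatMap nodes Φ))) (weight-concat-nodes onLeft Φ))

  ∑-wt-right : ∀ Φ → ∑ (λ v → weight (wt (δ (inj₂ v))) Φ) ≡ weight (wt onRight) Φ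
  ∑-wt-right Φ = trans (sum-cong-≗ (λ v → sym (weight-concat-nodes (δ (inj₂ v)) Φ)))
    (trans (sym (weight-onRight (concatMap nodes Φ))) (weight-concat-nodes onRight Φ))

  sizeᴸ : ∀ {v} → Limbs v → ℕ
  sizeᴸ = wtᴸ onLeft

  sizeᵀ : ∀ {u j} → Twigs u j → ℕ
  sizeᵀ = wtᵀ onLeft

  size : Tree → ℕ
  size = wt onLeft

  -- Every right vertex other than the root is a child of a left vertex, and each left vertex has h′
  -- children, its remaining neighbour being its parent.
  wt-onRightᴸ : ∀ {v} (l : Limbs v) → wtᴸ onRight l ≡ h′ * sizeᴸ l
  wt-onRightᵀ : ∀ {u j} (ts : Twigs u j) → wtᵀ onRight ts ≡ j + h′ * sizeᵀ ts
  wt-onRightᴸ []              = sym (*-zeroʳ h′)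
  wt-onRightᴸ (limb u _ ts l) =
    trans (cong₂ _+_ (wt-onRightᵀ ts) (wt-onRightᴸ l)) (rearrange h′ (sizeᵀ ts) (sizeᴸ l))
    where
    rearrange : ∀ h a b → h + h * a + h * b ≡ h * (1 + (a + b))
    rearrange = solve-∀
  wt-onRightᵀ []              = sym (*-zeroʳ h′)
  wt-onRightᵀ (twig {j} v _ l ts) =
    trans (cong₂ (λ a b → suc a + b) (wt-onRightᴸ l) (wt-onRightᵀ ts)) (rearrange h′ (sizeᴸ l) j (sizeᵀ ts))
    where
    rearrange : ∀ h a j b → 1 + h * a + (j + h * b) ≡ 1 + j + h * (0 + a + b)
    rearrange = solve-∀

  wt-onRight : ∀ t → wt onRight t ≡ 1 + h′ * size t
  wt-onRight (v , l) = cong suc (wt-onRightᴸ l)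

  weight-onRight-forest : ∀ Φ → weight (wt onRight) Φ ≡ length Φ + h′ * weight size Φ
  weight-onRight-forest []      = sym (*-zeroʳ h′)
  weight-onRight-forest (t ∷ Φ) =
    trans (cong₂ _+_ (wt-onRight t) (weight-onRight-forest Φ)) (rearrange h′ (size t) (length Φ) (weight size Φ))
    where
    rearrange : ∀ h a l b → 1 + h * a + (l + h * b) ≡ 1 + l + h * (a + b)
    rearrange = solve-∀

  _++ᵀ_ : ∀ {u i j} → Twigs u i → Twigs u j → Twigs u (i + j)
  []            ++ᵀ ts = ts
  twig v e l us ++ᵀ ts = twig v e l (us ++ᵀ ts)

  wt-++ᵀ : ∀ f {u i j} (us : Twigs u i) (ts : Twigs u j) → wtᵀ f (us ++ᵀ ts) ≡ wtᵀ f us + wtᵀ f ts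
  wt-++ᵀ f []              ts = refl
  wt-++ᵀ f (twig v e l us) ts =
    trans (cong (_+_ (f (inj₂ v) + wtᴸ f l)) (wt-++ᵀ f us ts)) (sym (+-assoc (f (inj₂ v) + wtᴸ f l) _ _))

  castᵀ : ∀ {u i j} → i ≡ j → Twigs u i → Twigs u j
  castᵀ refl ts = ts

  wt-castᵀ : ∀ f {u i j} (eq : i ≡ j) (ts : Twigs u i) → wtᵀ f (castᵀ eq ts) ≡ wtᵀ f ts
  wt-castᵀ f refl ts = refl

  -- `seen` collects what has been passed on the way to v: earlier siblings and,
  -- as one more subtree, the side of the old root.
  rerootᴸ : ∀ {r} (l seen : Limbs r) v → 1 ≤ wtᴸ (δ (inj₂ v)) l →
            Σ[ l′ ∈ Limbs v ] (∀ f → wt f (v , l′) ≡ f (inj₂ r) + (wtᴸ f l + wtᴸ f seen))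
  rerootᵀ : ∀ {u i j} (ts : Twigs u j) (seen : Twigs u i) → i + j ≡ suc h′ →
            ∀ v → 1 ≤ wtᵀ (δ (inj₂ v)) ts →
            Σ[ l′ ∈ Limbs v ] (∀ f → wt f (v , l′) ≡ f (inj₁ u) + (wtᵀ f ts + wtᵀ f seen))
  rerootᴸ {r} (limb u e ts l) seen v p with +-positive (wtᵀ (δ (inj₂ v)) ts) p
  ... | inj₁ q =
    let l′ , eq = rerootᵀ ts (twig r e (joined l seen) []) refl v q
    in l′ , λ f → trans (eq f) (trans (cong (λ a → f (inj₁ u) + (wtᵀ f ts + (f (inj₂ r) + a + 0))) (wt-joined f l seen))
                                      (rearrange (f (inj₁ u)) (wtᵀ f ts) (f (inj₂ r)) (wtᴸ f l) (wtᴸ f seen)))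
    where
    joined : ∀ {v} → Limbs v → Limbs v → Limbs v
    joined []              k = k
    joined (limb u e ts l) k = limb u e ts (joined l k)
    wt-joined : ∀ f {v} (l k : Limbs v) → wtᴸ f (joined l k) ≡ wtᴸ f l + wtᴸ f k
    wt-joined f []              k = refl
    wt-joined f (limb u e ts l) k =
      trans (cong (λ a → f (inj₁ u) + (wtᵀ f ts + a)) (wt-joined f l k)) (assoc₄ (f (inj₁ u)) (wtᵀ f ts) _ _)
      where
      assoc₄ : ∀ a b c d → a + (b + (c + d)) ≡ a + (b + c) + d
      assoc₄ = solve-∀
    rearrange : ∀ a b c d e → a + (b + (c + (d + e) + 0)) ≡ c + (a + (b + d) + e)
    rearrange = solve-∀
  ... | inj₂ q =
    let l′ , eq = rerootᴸ l (limb u e ts seen) v q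
    in l′ , λ f → trans (eq f) (rearrange (f (inj₁ u)) (wtᵀ f ts) (f (inj₂ r)) (wtᴸ f l) (wtᴸ f seen))
    where
    rearrange : ∀ a b c d e → c + (d + (a + (b + e))) ≡ c + (a + (b + d) + e)
    rearrange = solve-∀
  rerootᵀ {u} {i} {suc j} (twig w e l ts) seen i+j v p with +-positive (δ (inj₂ v) (inj₂ w) + wtᴸ (δ (inj₂ v)) l) p
  ... | inj₂ q =
    let l′ , eq = rerootᵀ ts (twig w e l seen) (trans (sym (+-suc i j)) i+j) v q
    in l′ , λ f → trans (eq f) (rearrange (f (inj₁ u)) (wtᵀ f ts) (f (inj₂ w)) (wtᴸ f l) (wtᵀ f seen))
    where
    rearrange : ∀ a b c d e → a + (b + (c + d + e)) ≡ a + (c + d + b + e)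
    rearrange = solve-∀
  ... | inj₁ q with +-positive (δ (inj₂ v) (inj₂ w)) q
  ...   | inj₂ r =
    let i+j≡h′ = suc-injective (trans (sym (+-suc i j)) i+j)
        rest   = castᵀ i+j≡h′ (seen ++ᵀ ts)
        l′ , eq = rerootᴸ l (limb u e rest []) v r
    in l′ , λ f → trans (eq f)
         (trans (cong (λ a → f (inj₂ w) + (wtᴸ f l + (f (inj₁ u) + (a + 0))))
                      (trans (wt-castᵀ f i+j≡h′ (seen ++ᵀ ts)) (wt-++ᵀ f seen ts)))
                (rearrange (f (inj₁ u)) (wtᵀ f ts) (f (inj₂ w)) (wtᴸ f l) (wtᵀ f seen)))
    where
    rearrange : ∀ a b c d e → c + (d + (a + (e + b + 0))) ≡ a + (c + d + b + e)
    rearrange = solve-∀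
  ...   | inj₁ r with indicator-positive (inj₂ v ≟ᵛ inj₂ w) r
  ...     | refl =
    let i+j≡h′ = suc-injective (trans (sym (+-suc i j)) i+j)
        rest   = castᵀ i+j≡h′ (seen ++ᵀ ts)
    in limb u e rest l , λ f →
         trans (cong (λ a → f (inj₂ w) + (f (inj₁ u) + (a + wtᴸ f l)))
                     (trans (wt-castᵀ f i+j≡h′ (seen ++ᵀ ts)) (wt-++ᵀ f seen ts)))
               (rearrange (f (inj₁ u)) (wtᵀ f ts) (f (inj₂ w)) (wtᴸ f l) (wtᵀ f seen))
    where
    rearrange : ∀ a b c d e → c + (a + (e + b + d)) ≡ a + (c + d + b + e)
    rearrange = solve-∀

  reroot : ∀ t v → 1 ≤ wt (δ (inj₂ v)) t → Σ[ l ∈ Limbs v ] (∀ f → wt f (v , l) ≡ wt f t)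
  reroot (r , l) v p with +-positive (δ (inj₂ v) (inj₂ r)) p
  ... | inj₂ q = let l′ , eq = rerootᴸ l [] v q
                 in l′ , λ f → trans (eq f) (cong (_+_ (f (inj₂ r))) (+-identityʳ (wtᴸ f l)))
  ... | inj₁ q with indicator-positive (inj₂ v ≟ᵛ inj₂ r) q
  ...   | refl = l , λ f → refl

  -- Parent, child, and the depth of the parent.
  Edge : Set
  Edge = Vertex m n × Vertex m n × ℕ

  edgesᴸ : ∀ i {v} → Limbs v → List Edge
  edgesᵀ : ∀ i {u j} → Twigs u j → List Edge
  edgesᴸ i     []                = []
  edgesᴸ i {v} (limb u _ ts l) = (inj₂ v , inj₁ u , i) ∷ (edgesᵀ (suc i) ts ++ edgesᴸ i l)
  edgesᵀ i     []                = []
  edgesᵀ i {u} (twig v _ l ts) = (inj₁ u , inj₂ v , i) ∷ (edgesᴸ (suc i) l ++ edgesᵀ i ts)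

  edges-soundᴸ : ∀ i {v} (l : Limbs v) {a b j} → (a , b , j) ∈ˡ edgesᴸ i l → Adjacent G a b
  edges-soundᵀ : ∀ i {u j} (ts : Twigs u j) {a b j} → (a , b , j) ∈ˡ edgesᵀ i ts → Adjacent G a b
  edges-soundᴸ i (limb u e ts l) (here refl) = e
  edges-soundᴸ i (limb u e ts l) (there p) with ∈-++⁻ (edgesᵀ (suc i) ts) p
  ... | inj₁ q = edges-soundᵀ (suc i) ts q
  ... | inj₂ q = edges-soundᴸ i l q
  edges-soundᵀ i (twig v e l ts) (here refl) = e
  edges-soundᵀ i (twig v e l ts) (there p) with ∈-++⁻ (edgesᴸ (suc i) l) p
  ... | inj₁ q = edges-soundᴸ (suc i) l q
  ... | inj₂ q = edges-soundᵀ i ts q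

  module _ (x : Fin m) (g : Fin n → ℕ) where

    CoversEdges : List Edge → Set
    CoversEdges E = ∀ {v j} → (inj₂ v , inj₁ x , j) ∈ˡ E ⊎ (inj₁ x , inj₂ v , j) ∈ˡ E → 1 ≤ g v

    covers-⊆ : ∀ {E E′} → (∀ {e} → e ∈ˡ E′ → e ∈ˡ E) → CoversEdges E → CoversEdges E′
    covers-⊆ sub covers (inj₁ p) = covers (inj₁ (sub p))
    covers-⊆ sub covers (inj₂ p) = covers (inj₂ (sub p))

    covered-children : ∀ i {j} (ts : Twigs x j) → CoversEdges (edgesᵀ i ts) → j ≤ wtᵀ (rightWeight g) ts
    covered-children i []              _      = z≤n
    covered-children i (twig v e l ts) covers =
      +-mono-≤ (≤-trans (covers (inj₂ (here refl))) (m≤m+n (g v) _))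
               (covered-children i ts (covers-⊆ (there ∘ ∈-++⁺ʳ (edgesᴸ (suc i) l)) covers))

    -- The parent of x and its h′ children are separate nodes of the tree, so a weight that is
    -- positive on each of them totals at least h. This serves both for neighbours in G and for
    -- neighbours in the final edge set.
    covered-degreeᴸ : ∀ i {v} (l : Limbs v) → CoversEdges (edgesᴸ i l) → 1 ≤ wtᴸ (δ (inj₁ x)) l →
                      suc h′ ≤ wt (rightWeight g) (v , l)
    covered-degreeᵀ : ∀ i {u j} (ts : Twigs u j) → CoversEdges (edgesᵀ i ts) → 1 ≤ wtᵀ (δ (inj₁ x)) ts →
                      suc h′ ≤ wtᵀ (rightWeight g) ts
    covered-degreeᴸ i {v} (limb u e ts l) covers p with +-positive (δ (inj₁ x) (inj₁ u)) p
    ... | inj₁ q with indicator-positive (inj₁ x ≟ᵛ inj₁ u) q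
    ...   | refl = +-mono-≤ (covers (inj₁ (here refl)))
      (≤-trans (covered-children (suc i) ts (covers-⊆ (there ∘ ∈-++⁺ˡ) covers)) (m≤m+n _ _))
    covered-degreeᴸ i {v} (limb u e ts l) covers p | inj₂ q with +-positive (wtᵀ (δ (inj₁ x)) ts) q
    ... | inj₁ r = ≤-trans (covered-degreeᵀ (suc i) ts (covers-⊆ (there ∘ ∈-++⁺ˡ) covers) r)
                           (≤-trans (m≤m+n _ _) (m≤n+m _ (g v)))
    ... | inj₂ r = ≤-trans (covered-degreeᴸ i l (covers-⊆ (there ∘ ∈-++⁺ʳ (edgesᵀ (suc i) ts)) covers) r)
                           (+-monoʳ-≤ (g v) (m≤n+m _ _))
    covered-degreeᵀ i (twig v e l ts) covers p with +-positive (wtᴸ (δ (inj₁ x)) l) p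
    ... | inj₁ r = ≤-trans (covered-degreeᴸ (suc i) l (covers-⊆ (there ∘ ∈-++⁺ˡ) covers) r) (m≤m+n _ _)
    ... | inj₂ r = ≤-trans (covered-degreeᵀ i ts (covers-⊆ (there ∘ ∈-++⁺ʳ (edgesᴸ (suc i) l)) covers) r) (m≤n+m _ _)

-- Exchange moves on the reached trees.

module Exploration {m n : ℕ} (G : BipartiteGraph m n) (h′ k : ℕ) where
  open Trees G h′ public

  -- A tree of the current forest, rooted at the vertex through which it was
  -- reached from `parent` along an edge outside the forest.
  record Reached : Set where
    constructor reached
    field
      {parent} : Fin m
      {root}   : Fin n
      link     : root ∈ G parent
      limbs    : Limbs root
    tree : Tree
    tree = root , limbs

  open Reached public

  -- Exchanging edges at the parent of W turns a tree and W into a smaller tree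
  -- with the same root and a remainder `cut`.
  record Improvement {A : Set} (wtᴬ : (Vertex m n → ℕ) → A → ℕ) (W : Reached) (a : A) : Set where
    constructor improvement
    field
      result   : A
      cut      : Tree
      smaller  : wtᴬ onLeft result < wtᴬ onLeft a
      fits     : size cut ≤ k
      conserve : ∀ f → wtᴬ f a + wt f (tree W) ≡ wtᴬ f result + wt f cut

  Bounded : ∀ {u j} → ℕ → Twigs u j → Set
  Bounded c []              = ⊤
  Bounded c (twig _ _ l ts) = sizeᴸ l ≤ c × Bounded c ts

  -- The two conjuncts at the parent of W are the failures of the two moves: hanging the limb at u
  -- below the root of W would give more than k left vertices, and no twig of u is larger than W, so
  -- trading one for W would not shrink the tree.
  Settledᴸ : Reached → ∀ {v} → Limbs v → Set
  Settledᵀ : Reached → ∀ {u j} → Twigs u j → Set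
  Settledᴸ W []              = ⊤
  Settledᴸ W (limb u _ ts l) =
    (parent W ≡ u → k < suc (sizeᵀ ts) + size (tree W) × Bounded (size (tree W)) ts) ×
    Settledᵀ W ts × Settledᴸ W l
  Settledᵀ W []              = ⊤
  Settledᵀ W (twig _ _ l ts) = Settledᴸ W l × Settledᵀ W ts

  module _ {A : Set} {wtᴬ : (Vertex m n → ℕ) → A → ℕ} {B : Set} {wtᴮ : (Vertex m n → ℕ) → B → ℕ}
           (frame : (Vertex m n → ℕ) → ℕ) (plug : A → B)
           (wt-plug : ∀ f a → wtᴮ f (plug a) ≡ frame f + wtᴬ f a) where

    -- `plug` is a context with one hole and `frame` the weight of its fixed part, which cancels
    -- from both the comparison of sizes and the conservation law.
    lift-improvement : ∀ {W a} → Improvement wtᴬ W a → Improvement wtᴮ W (plug a)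
    lift-improvement {W} {a} (improvement a′ cut smaller fits conserve) = record
      { result   = plug a′
      ; cut      = cut
      ; smaller  = begin-strict
          wtᴮ onLeft (plug a′)           ≡⟨ wt-plug onLeft a′ ⟩
          frame onLeft + wtᴬ onLeft a′  <⟨ +-monoʳ-< (frame onLeft) smaller ⟩
          frame onLeft + wtᴬ onLeft a   ≡⟨ wt-plug onLeft a ⟨
          wtᴮ onLeft (plug a)            ∎
      ; fits     = fits
      ; conserve = λ f → trans (cong (_+ wt f (tree W)) (wt-plug f a))
          (trans (+-assoc (frame f) _ _) (trans (cong (_+_ (frame f)) (conserve f))
          (trans (sym (+-assoc (frame f) _ _)) (cong (_+ wt f cut) (sym (wt-plug f a′))))))
      }
      where open ≤-Reasoning

  swapTwig : ∀ (W : Reached) {j} (ts : Twigs (parent W) j) → sizeᵀ ts ≤ k →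
             Bounded (size (tree W)) ts ⊎ Improvement (λ f → wtᵀ f) W ts
  swapTwig W []                _ = inj₁ tt
  swapTwig W (twig v e l ts) fit with sizeᴸ l ≤? size (tree W)
  ... | no  l≰W = inj₂ record
    { result   = twig (root W) (link W) (limbs W) ts
    ; cut      = v , l
    ; smaller  = +-monoˡ-< (sizeᵀ ts) (≰⇒> l≰W)
    ; fits     = ≤-trans (m≤m+n _ _) fit
    ; conserve = λ f → rearrange (f (inj₂ v) + wtᴸ f l) (wtᵀ f ts) (wt f (tree W))
    }
    where
    rearrange : ∀ a b c → a + b + c ≡ c + b + a
    rearrange = solve-∀
  ... | yes l≤W with swapTwig W ts (≤-trans (m≤n+m _ _) fit)
  ...   | inj₁ bounded = inj₁ (l≤W , bounded)
  ...   | inj₂ imp     = inj₂ (lift-improvement (λ f → wt f (v , l)) (twig v e l) (λ _ _ → refl) imp)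

  limb-frame : ∀ (a b c : ℕ) → a + (b + c) ≡ a + c + b
  limb-frame = solve-∀

  improveᴸ : ∀ W {v} (l : Limbs v) → sizeᴸ l ≤ k → Settledᴸ W l ⊎ Improvement (λ f → wtᴸ f) W l
  improveᵀ : ∀ W {u j} (ts : Twigs u j) → sizeᵀ ts ≤ k → Settledᵀ W ts ⊎ Improvement (λ f → wtᵀ f) W ts
  -- Either move exchanges one forest edge at u for `link W`, so the degree of u stays h: one move
  -- gives up the edge to the parent of u, the other the edge to a child.
  improveAt : ∀ W {v} u (e : v ∈ G u) ts l → sizeᴸ (limb u e ts l) ≤ k →
              (parent W ≡ u → k < suc (sizeᵀ ts) + size (tree W) × Bounded (size (tree W)) ts) ⊎
              Improvement (λ f → wtᴸ f) W (limb u e ts l)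

  improveᴸ W []                fit = inj₁ tt
  improveᴸ W (limb u e ts l) fit with improveAt W u e ts l fit
  ... | inj₂ imp = inj₂ imp
  ... | inj₁ here-settled with improveᵀ W ts (≤-trans (m≤n⇒m≤1+n (m≤m+n _ _)) fit)
  ...   | inj₂ imp = inj₂ (lift-improvement (λ f → f (inj₁ u) + wtᴸ f l) (λ ts → limb u e ts l)
                            (λ f ts → limb-frame (f (inj₁ u)) (wtᵀ f ts) (wtᴸ f l)) imp)
  ...   | inj₁ ts-settled with improveᴸ W l (≤-trans (m≤n⇒m≤1+n (m≤n+m _ _)) fit)
  ...     | inj₂ imp = inj₂ (lift-improvement (λ f → f (inj₁ u) + wtᵀ f ts) (limb u e ts)
                              (λ f l → sym (+-assoc (f (inj₁ u)) (wtᵀ f ts) (wtᴸ f l))) imp)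
  ...     | inj₁ l-settled = inj₁ (here-settled , ts-settled , l-settled)

  improveᵀ W []                fit = inj₁ tt
  improveᵀ W (twig v e l ts) fit with improveᴸ W l (≤-trans (m≤m+n _ _) fit)
  ... | inj₂ imp = inj₂ (lift-improvement (λ f → f (inj₂ v) + wtᵀ f ts) (λ l → twig v e l ts)
                          (λ f l → comm-last (f (inj₂ v)) (wtᴸ f l) (wtᵀ f ts)) imp)
    where
    comm-last : ∀ (a b c : ℕ) → a + b + c ≡ a + c + b
    comm-last = solve-∀
  ... | inj₁ l-settled with improveᵀ W ts (≤-trans (m≤n+m _ _) fit)
  ...   | inj₂ imp = inj₂ (lift-improvement (λ f → wt f (v , l)) (twig v e l) (λ _ _ → refl) imp)
  ...   | inj₁ ts-settled = inj₁ (l-settled , ts-settled)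

  improveAt W {v} u e ts l fit with parent W ≟ u
  ... | no  W≢u  = inj₁ (λ W≡u → contradiction W≡u W≢u)
  ... | yes refl with suc (sizeᵀ ts) + size (tree W) ≤? k
  ...   | yes small = inj₂ record
    { result   = l
    ; cut      = root W , limb u (link W) ts (limbs W)
    ; smaller  = s≤s (m≤n+m _ _)
    ; fits     = ≤-trans (≤-reflexive (+-assoc 1 (sizeᵀ ts) (size (tree W)))) small
    ; conserve = λ f → rearrange (f (inj₁ u)) (wtᵀ f ts) (wtᴸ f l) (f (inj₂ (root W))) (wtᴸ f (limbs W))
    }
    where
    rearrange : ∀ a b c d e → a + (b + c) + (d + e) ≡ c + (d + (a + (b + e)))
    rearrange = solve-∀
  ...   | no  large with swapTwig W ts (≤-trans (m≤n⇒m≤1+n (m≤m+n _ _)) fit)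
  ...     | inj₁ bounded = inj₁ (λ _ → ≰⇒> large , bounded)
  ...     | inj₂ imp     = inj₂ (lift-improvement (λ f → f (inj₁ u) + wtᴸ f l) (λ ts → limb u e ts l)
                                  (λ f ts → limb-frame (f (inj₁ u)) (wtᵀ f ts) (wtᴸ f l)) imp)

  -- The explored sequence, its rank and its decrease.

  Fits : Tree → Set
  Fits t = size t ≤ k

  Forest : Set
  Forest = List Tree

  wtᶠ : (Vertex m n → ℕ) → Forest → ℕ
  wtᶠ f = weight (wt f)

  wtᴿ : (Vertex m n → ℕ) → List Reached → ℕ
  wtᴿ f = weight (λ W → wt f (tree W))

  weight-map-tree : ∀ f P → wtᶠ f (map tree P) ≡ wtᴿ f P
  weight-map-tree f []      = refl
  weight-map-tree f (W ∷ P) = cong (_+_ (wt f (tree W))) (weight-map-tree f P)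

  occurs : Tree → Fin m → ℕ
  occurs t u = wt (δ (inj₁ u)) t

  -- e counts the occurrences of a left vertex among those seen before the list.
  Valid : (Fin m → ℕ) → List Reached → Set
  Valid e []      = ⊤
  Valid e (C ∷ P) = 1 ≤ e (parent C) × Valid (λ u → e u + occurs (tree C) u) P

  Settled : List Reached → Set
  Settled []      = ⊤
  Settled (C ∷ P) = All (λ W → Settledᴸ W (limbs C)) P × Settled P

  base : ℕ
  base = 2 + k

  -- The lexicographic order on size sequences, with the end of the sequence above
  -- every size, as a number in base k + 2.
  rank : ℕ → List Reached → ℕ
  rank zero    P       = 1
  rank (suc i) []      = base ^ suc i
  rank (suc i) (C ∷ P) = size (tree C) * base ^ i + rank i P

  -- When C shrinks by a single left vertex, the end marker put after it uses up the whole gain of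
  -- `base ^ i`; the positive rank of the dropped tail keeps the decrease strict.
  rank-positive : ∀ i P → 1 ≤ rank i P
  rank-positive zero    P       = ≤-refl
  rank-positive (suc i) []      = m^n>0 base (suc i)
  rank-positive (suc i) (C ∷ P) = ≤-trans (rank-positive i P) (m≤n+m _ _)

  rank-[] : ∀ i → rank i [] ≡ base ^ i
  rank-[] zero    = refl
  rank-[] (suc i) = refl

  record Progress (e : Fin m → ℕ) (i : ℕ) (P : List Reached) : Set where
    field
      {explored}  : List Reached
      {discarded} : Forest
      valid       : Valid e explored
      fits        : All Fits (map tree explored)
      fits′       : All Fits discarded
      decrease    : rank i explored < rank i P
      conserve    : ∀ f → wtᴿ f P ≡ wtᴿ f explored + wtᶠ f discarded

  scan : ∀ {v} (l : Limbs v) → sizeᴸ l ≤ k → ∀ P → All Fits (map tree P) →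
         All (λ W → Settledᴸ W l) P ⊎
         Σ[ W ∈ Reached ] Σ[ Φ ∈ Forest ]
           All Fits Φ × (∀ f → wtᴿ f P ≡ wt f (tree W) + wtᶠ f Φ) × Improvement (λ f → wtᴸ f) W l
  scan l fit []      []            = inj₁ []
  scan l fit (W ∷ P) (W-fits ∷ fits) with improveᴸ W l fit
  ... | inj₂ imp = inj₂ (W , map tree P , fits , (λ f → cong (_+_ (wt f (tree W))) (sym (weight-map-tree f P))) , imp)
  ... | inj₁ settled with scan l fit P fits
  ...   | inj₁ all-settled = inj₁ (settled ∷ all-settled)
  ...   | inj₂ (V , Φ , Φ-fits , eq , imp) =
    inj₂ (V , tree W ∷ Φ , W-fits ∷ Φ-fits ,
          (λ f → trans (cong (_+_ (wt f (tree W))) (eq f)) (exchange (wt f (tree W)) (wt f (tree V)) (wtᶠ f Φ))) , imp)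
    where
    exchange : ∀ (a b c : ℕ) → a + (b + c) ≡ b + (a + c)
    exchange = solve-∀

  progress : ∀ e i P → length P ≤ i → Valid e P → All Fits (map tree P) → Settled P ⊎ Progress e i P
  progress e i       []      _        _             _            = inj₁ tt
  progress e (suc i) (C ∷ P) (s≤s P≤i) (seen , valid) (fit ∷ fits) with scan (limbs C) fit P fits
  ... | inj₂ (W , Φ , Φ-fits , eq , imp) = inj₂ record
    -- The trees after C are returned to the forest because their parents may now lie in `cut`. C
    -- keeps its root and its link, since its parent was seen before it.
    { explored  = reached (link C) result ∷ []
    ; discarded = cut ∷ Φ
    ; valid     = seen , tt
    ; fits      = ≤-trans (<⇒≤ smaller) fit ∷ []
    ; fits′     = cut-fits ∷ Φ-fits
    ; decrease  = begin-strict
        sizeᴸ result * base ^ i + rank i []  ≡⟨ cong (_+_ (sizeᴸ result * base ^ i)) (rank-[] i) ⟩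
        sizeᴸ result * base ^ i + base ^ i   ≡⟨ +-comm (sizeᴸ result * base ^ i) (base ^ i) ⟩
        suc (sizeᴸ result) * base ^ i        ≤⟨ *-monoˡ-≤ (base ^ i) smaller ⟩
        sizeᴸ (limbs C) * base ^ i           <⟨ m<m+n _ (rank-positive i P) ⟩
        sizeᴸ (limbs C) * base ^ i + rank i P ∎
    ; conserve  = λ f → begin-equality
        f (inj₂ (root C)) + wtᴸ f (limbs C) + wtᴿ f P
          ≡⟨ cong (_+_ (f (inj₂ (root C)) + wtᴸ f (limbs C))) (eq f) ⟩
        f (inj₂ (root C)) + wtᴸ f (limbs C) + (wt f (tree W) + wtᶠ f Φ)
          ≡⟨ rearrange₁ (f (inj₂ (root C))) (wtᴸ f (limbs C)) (wt f (tree W)) (wtᶠ f Φ) ⟩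
        f (inj₂ (root C)) + (wtᴸ f (limbs C) + wt f (tree W)) + wtᶠ f Φ
          ≡⟨ cong (λ a → f (inj₂ (root C)) + a + wtᶠ f Φ) (imp-conserve f) ⟩
        f (inj₂ (root C)) + (wtᴸ f result + wt f cut) + wtᶠ f Φ
          ≡⟨ rearrange₂ (f (inj₂ (root C))) (wtᴸ f result) (wt f cut) (wtᶠ f Φ) ⟩
        f (inj₂ (root C)) + wtᴸ f result + 0 + (wt f cut + wtᶠ f Φ) ∎
    }
    where
    open ≤-Reasoning
    open Improvement imp renaming (fits to cut-fits; conserve to imp-conserve)
    rearrange₁ : ∀ (a b c d : ℕ) → a + b + (c + d) ≡ a + (b + c) + d
    rearrange₁ = solve-∀
    rearrange₂ : ∀ (a b c d : ℕ) → a + (b + c) + d ≡ a + b + 0 + (c + d)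
    rearrange₂ = solve-∀
  ... | inj₁ settled with progress (λ u → e u + occurs (tree C) u) i P P≤i valid fits
  ...   | inj₁ all-settled = inj₁ (settled , all-settled)
  ...   | inj₂ p = inj₂ record
    { explored  = C ∷ P.explored
    ; discarded = P.discarded
    ; valid     = seen , P.valid
    ; fits      = fit ∷ P.fits
    ; fits′     = P.fits′
    ; decrease  = +-monoʳ-< (size (tree C) * base ^ i) P.decrease
    ; conserve  = λ f → trans (cong (_+_ (wt f (tree C))) (P.conserve f)) (sym (+-assoc (wt f (tree C)) _ _))
    }
    where module P = Progress p

  append-valid : ∀ e P W → Valid e P → 1 ≤ e (parent W) + wtᴿ (δ (inj₁ (parent W))) P → Valid e (P ++ W ∷ [])
  append-valid e []      W _              seen = subst (1 ≤_) (+-identityʳ _) seen , tt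
  append-valid e (C ∷ P) W (seenC , valid) seen =
    seenC , append-valid _ P W valid (subst (1 ≤_) (sym (+-assoc (e (parent W)) _ _)) seen)

  append-rank : ∀ i P W → length P < i → size (tree W) ≤ k → rank i (P ++ W ∷ []) < rank i P
  append-rank (suc i) []      W _         fit = begin-strict
    size (tree W) * base ^ i + rank i []  ≡⟨ cong (_+_ (size (tree W) * base ^ i)) (rank-[] i) ⟩
    size (tree W) * base ^ i + base ^ i   ≡⟨ +-comm (size (tree W) * base ^ i) (base ^ i) ⟩
    -- This step fixes the base: a size of at most k followed by the end marker costs at most
    -- `(k + 1) * base ^ i`, which has to be less than the marker it replaces.
    suc (size (tree W)) * base ^ i        <⟨ *-monoˡ-< (base ^ i) {{m^n≢0 base i}} (s≤s (s≤s fit)) ⟩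
    base * base ^ i                       ∎
    where open ≤-Reasoning
  append-rank (suc i) (C ∷ P) W (s≤s P<i) fit = +-monoʳ-< (size (tree C) * base ^ i) (append-rank i P W P<i fit)

  total : List (Fin m) → (Vertex m n → ℕ) → ℕ
  total us f = ∑ (λ v → f (inj₂ v)) + weight (λ u → f (inj₁ u)) us

  -- For f = `δ x` the equation says that x occurs in the forest exactly as often as in V together
  -- with `us`. For `us` without repetition the trees are thus disjoint and cover precisely these
  -- vertices.
  Spanning : List (Fin m) → Forest → Set
  Spanning us Φ = All Fits Φ × (∀ f → wtᶠ f Φ ≡ total us f)

-- Selecting the smallest entries of a list.

module _ (s : A → ℕ) where

  extract-min : ∀ x xs → ∃[ y ] ∃[ ys ] (x ∷ xs ↭ y ∷ ys × All (λ z → s y ≤ s z) ys)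
  extract-min x []       = x , [] , ↭-refl , []
  extract-min x (z ∷ xs) with extract-min z xs
  ... | y , ys , p , y≤ys with s x ≤? s y
  ...   | yes x≤y = x , z ∷ xs , ↭-refl , All-resp-↭ (↭-sym p) (x≤y ∷ All.map (≤-trans x≤y) y≤ys)
  ...   | no  x≰y = y , x ∷ ys , ↭-trans (prep x p) (swap x y ↭-refl) , <⇒≤ (≰⇒> x≰y) ∷ y≤ys

  -- The entry c is the largest of the i + 1 selected ones. It is kept apart because its size
  -- separates the trees that u would join from the remaining ones.
  select : ∀ i xs → i < length xs →
           ∃[ ys ] ∃[ c ] ∃[ zs ] (xs ↭ c ∷ (ys ++ zs) × length ys ≡ i ×
                                   All (λ y → s y ≤ s c) ys × All (λ z → s c ≤ s z) zs)
  select i       (x ∷ xs) i<xs with extract-min x xs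
  select zero    (x ∷ xs) i<xs       | y , ys , p , y≤ys = [] , y , ys , p , refl , [] , y≤ys
  select (suc i) (x ∷ xs) i<xs       | y , ys , p , y≤ys
    with select i ys (≤-pred (subst (suc i <_) (↭-length p) i<xs))
  ... | ys′ , c , zs , p′ , len , ys≤c , c≤zs =
    y ∷ ys′ , c , zs , ↭-trans p (↭-trans (prep y p′) (swap y c ↭-refl)) , cong suc len ,
    All.head (All-resp-↭ p′ y≤ys) ∷ ys≤c , c≤zs

weight-↭ : ∀ (f : A → ℕ) {xs ys} → xs ↭ ys → weight f xs ≡ weight f ys
weight-↭ f p = sum-↭ (map⁺ f p)

weight-≤ : ∀ (f : A → ℕ) c {xs} → All (λ x → f x ≤ c) xs → weight f xs ≤ length xs * c
weight-≤ f c []        = z≤n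
weight-≤ f c (p ∷ ps) = +-mono-≤ p (weight-≤ f c ps)

-- Compensation of short trees by large ones.

module Counting {m n : ℕ} (G : BipartiteGraph m n) (h′ k D′ q : ℕ)
  (q-positive : 1 ≤ q) (2q≤1+k : q + q ≤ suc k) (q-least : ∀ w → k ≤ suc h′ * w → q ≤ w) where
  open Exploration G h′ k public

  -- With h = `suc h′` and d = h + D, the fraction in the hypothesis is E / B. D bounds the number
  -- of edges of G at a left vertex that are not in its tree.
  D E B : ℕ
  D = suc D′
  E = suc D
  B = suc k + D′ * q

  -- B / E is the threshold for the average size of the reached trees.
  short excess : ℕ → ℕ
  short  c = B ∸ E * c
  excess c = E * c ∸ B

  short-excess : ∀ c → E * c + short c ≡ B + excess c
  short-excess c with ≤-total B (E * c)
  ... | inj₁ B≤Ec rewrite m≤n⇒m∸n≡0 B≤Ec = trans (+-identityʳ (E * c)) (sym (m+[n∸m]≡n B≤Ec))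
  ... | inj₂ Ec≤B rewrite m≤n⇒m∸n≡0 Ec≤B = trans (m+[n∸m]≡n Ec≤B) (sym (+-identityʳ B))

  -- From 2q ≤ k + 1 follows 2B ≤ (2 + D′)(k + 1) = E (k + 1), so the threshold B / E is at most (k
  -- + 1) / 2.
  small⇒half : ∀ w → E * w < B → w + w ≤ k
  small⇒half w Ew<B = ≤-pred (*-cancelˡ-< E (w + w) (suc k) (begin-strict
    E * (w + w)                    ≡⟨ *-distribˡ-+ E w w ⟩
    E * w + E * w                  <⟨ +-mono-< Ew<B Ew<B ⟩
    B + B                          ≡⟨ rearrange (suc k) D′ q ⟩
    suc k + suc k + D′ * (q + q)   ≤⟨ +-monoʳ-≤ (suc k + suc k) (*-monoʳ-≤ D′ 2q≤1+k) ⟩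
    suc k + suc k + D′ * suc k     ≡⟨ +-assoc (suc k) (suc k) (D′ * suc k) ⟩
    E * suc k                      ∎))
    where
    open ≤-Reasoning
    rearrange : ∀ a b c → a + b * c + (a + b * c) ≡ a + a + b * (c + c)
    rearrange = solve-∀

  -- Since E = D′ + 2, subtracting E q from B cancels D′ q and leaves `short q` + 2q = k + 1; then q
  -- ≥ 1 absorbs the surplus 1.
  small-threshold : ∀ w → E * q ≤ B → w ≡ short q → w + q ≤ k
  small-threshold w Eq≤B refl = ≤-pred (begin
    suc (short q + q)   ≡⟨ +-suc (short q) q ⟨
    short q + suc q     ≤⟨ +-monoʳ-≤ (short q) (+-monoˡ-≤ q q-positive) ⟩
    short q + (q + q)   ≡⟨ +-cancelʳ-≡ (D′ * q) _ _ (trans (rearrange (short q) q D′) (m∸n+n≡m Eq≤B)) ⟩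
    suc k               ∎)
    where
    open ≤-Reasoning
    rearrange : ∀ a b d → a + (b + b) + d * b ≡ a + (b + (b + d * b))
    rearrange = solve-∀

  children : List Reached → Fin m → ℕ
  children Q u = weight (λ W → indicator (parent W ≟ u)) Q

  shortfall : List Reached → Fin m → ℕ
  shortfall Q u = weight (λ W → indicator (parent W ≟ u) * short (size (tree W))) Q

  -- The smallest of the short children lacks most and so bounds what each of the others lacks. The
  -- later estimates therefore involve a single size.
  shortest-child : ∀ Q u → shortfall Q u ≡ 0 ⊎
    Σ[ W ∈ Reached ] (W ∈ˡ Q × parent W ≡ u × E * size (tree W) < B ×
                      shortfall Q u ≤ children Q u * short (size (tree W)))
  shortest-child []      u = inj₁ refl
  shortest-child (W ∷ Q) u with parent W ≟ u | shortest-child Q u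
  ... | no _  | inj₁ none = inj₁ none
  ... | no _  | inj₂ (V , V∈Q , rest) = inj₂ (V , there V∈Q , rest)
  ... | yes p | r with E * size (tree W) <? B
  shortest-child (W ∷ Q) u | yes p | inj₁ none | no W≮B =
    inj₁ (cong₂ _+_ (trans (*-identityˡ _) (m≤n⇒m∸n≡0 (≮⇒≥ W≮B))) none)
  shortest-child (W ∷ Q) u | yes p | inj₂ (V , V∈Q , V≡u , V<B , bound) | no W≮B =
    inj₂ (V , there V∈Q , V≡u , V<B ,
          +-mono-≤ (≤-trans (≤-reflexive (trans (*-identityˡ _) (m≤n⇒m∸n≡0 (≮⇒≥ W≮B)))) z≤n) bound)
  shortest-child (W ∷ Q) u | yes p | inj₁ none | yes W<B =
    inj₂ (W , here refl , p , W<B ,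
          +-mono-≤ (≤-reflexive (*-identityˡ _)) (≤-trans (≤-reflexive none) z≤n))
  shortest-child (W ∷ Q) u | yes p | inj₂ (V , V∈Q , V≡u , V<B , bound) | yes W<B
    with ≤-total (short (size (tree W))) (short (size (tree V)))
  ... | inj₁ W≤V = inj₂ (V , there V∈Q , V≡u , V<B ,
                         +-mono-≤ (≤-trans (≤-reflexive (*-identityˡ _)) W≤V) bound)
  ... | inj₂ V≤W = inj₂ (W , here refl , p , W<B ,
                         +-mono-≤ (≤-reflexive (*-identityˡ _)) (≤-trans bound (*-monoʳ-≤ (children Q u) V≤W)))

  bounded-size : ∀ c {u j} (ts : Twigs u j) → Bounded c ts → sizeᵀ ts ≤ j * c
  bounded-size c []              _            = z≤n
  bounded-size c (twig v _ l ts) (l≤c , rest) = +-mono-≤ l≤c (bounded-size c ts rest)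

  module _ (Q : List Reached) where

    τ : Vertex m n → ℕ
    τ = leftWeight (shortfall Q)

    -- Short children have fewer than (k + 1) / 2 left vertices, so the no-move
    -- conditions leave room for at most one left vertex with short children.
    Concentrated : ℕ → ℕ → ℕ → Set
    Concentrated s t w = E * w < B × k < s + w × k ≤ suc h′ * w × t ≤ D * short w

    widen : ∀ {s s′ t t′} w → s ≤ s′ → t′ ≡ t → Concentrated s t w → Concentrated s′ t′ w
    widen w s≤s′ refl (small , k<s+w , rest) = small , <-≤-trans k<s+w (+-monoˡ-≤ w s≤s′) , rest

    -- The two lower bounds and a + b ≤ k give w + w′ > k, although both w and w′ are at most k / 2.
    -- Everything is doubled to avoid halves.
    clash : ∀ {a b} w w′ → a + b ≤ k → E * w < B → E * w′ < B → k < a + w → k < b + w′ → ⊥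
    clash {a} {b} w w′ a+b≤k small small′ k<a+w k<b+w′ = <-irrefl refl (begin-strict
      k + k + (k + k)                      <⟨ +-mono-< (+-mono-< k<a+w k<b+w′) (+-mono-< k<a+w k<b+w′) ⟩
      a + w + (b + w′) + (a + w + (b + w′))  ≡⟨ rearrange a b w w′ ⟩
      a + b + (a + b) + (w + w + (w′ + w′))  ≤⟨ +-mono-≤ (+-mono-≤ a+b≤k a+b≤k)
                                                  (+-mono-≤ (small⇒half w small) (small⇒half w′ small′)) ⟩
      k + k + (k + k)                      ∎)
      where
      open ≤-Reasoning
      rearrange : ∀ a b w w′ → a + w + (b + w′) + (a + w + (b + w′)) ≡ a + b + (a + b) + (w + w + (w′ + w′))
      rearrange = solve-∀

    AtMostD : ((Vertex m n → ℕ) → ℕ) → Set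
    AtMostD count = ∀ u → 1 ≤ count (δ (inj₁ u)) → children Q u ≤ D

    -- Two left vertices with short children cannot lie in disjoint subtrees, by `clash`. If x lies
    -- below u, then the twig of u that contains x and a short child of x together exceed k; but
    -- this twig is at most as large as a short child of u, so two sizes of at most k / 2 would
    -- exceed k. The last clause for `Twigs` carries this information up to u, for any bound c on
    -- its twigs.
    concentrateᴸ : ∀ {v} (l : Limbs v) → sizeᴸ l ≤ k → All (λ W → Settledᴸ W l) Q → AtMostD (λ f → wtᴸ f l) →
                   wtᴸ τ l ≡ 0 ⊎ ∃[ w ] Concentrated (sizeᴸ l) (wtᴸ τ l) w
    concentrateᵀ : ∀ {u j} (ts : Twigs u j) → sizeᵀ ts ≤ k → All (λ W → Settledᵀ W ts) Q → AtMostD (λ f → wtᵀ f ts) →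
                   wtᵀ τ ts ≡ 0 ⊎ ∃[ w ] (Concentrated (sizeᵀ ts) (wtᵀ τ ts) w × (∀ c → Bounded c ts → k < c + w))
    concentrateᴸ []              _   _       _    = inj₁ refl
    concentrateᴸ (limb u e ts l) fit settled few
      with concentrateᵀ ts (≤-trans (m≤n⇒m≤1+n (m≤m+n _ _)) fit) (All.map (proj₁ ∘ proj₂) settled)
             (λ x p → few x (≤-trans p (≤-trans (m≤m+n _ _) (m≤n+m _ (δ (inj₁ x) (inj₁ u))))))
         | concentrateᴸ l (≤-trans (m≤n⇒m≤1+n (m≤n+m _ _)) fit) (All.map (proj₂ ∘ proj₂) settled)
             (λ x p → few x (≤-trans p (≤-trans (m≤n+m _ _) (m≤n+m _ (δ (inj₁ x) (inj₁ u))))))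
         | shortest-child Q u
    ... | inj₁ ts≡0 | inj₁ l≡0 | inj₁ u≡0 = inj₁ (cong₂ _+_ u≡0 (cong₂ _+_ ts≡0 l≡0))
    ... | inj₁ ts≡0 | inj₂ (w , conc) | inj₁ u≡0 =
      inj₂ (w , widen w (m≤n⇒m≤1+n (m≤n+m _ _)) (cong₂ _+_ u≡0 (cong (_+ wtᴸ τ l) ts≡0)) conc)
    ... | inj₂ (w , conc , _) | inj₁ l≡0 | inj₁ u≡0 =
      inj₂ (w , widen w (m≤n⇒m≤1+n (m≤m+n _ _))
                  (cong₂ _+_ u≡0 (trans (cong (_+_ (wtᵀ τ ts)) l≡0) (+-identityʳ _))) conc)
    ... | inj₂ (w , (small , p , _) , _) | inj₂ (w′ , small′ , p′ , _) | _ =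
      ⊥-elim (clash w w′ (≤-trans (n≤1+n _) fit) small small′ p p′)
    ... | inj₂ (w , (small , _) , out) | inj₁ _ | inj₂ (W , W∈Q , refl , W-small , _) =
      let _ , bounded = proj₁ (All.lookup settled W∈Q) refl
      in ⊥-elim (<-irrefl refl (<-≤-trans (+-mono-< (out _ bounded) (out _ bounded))
           (≤-trans (≤-reflexive (rearrange (size (tree W)) w))
                    (+-mono-≤ (small⇒half (size (tree W)) W-small) (small⇒half w small)))))
      where
      rearrange : ∀ a b → a + b + (a + b) ≡ a + a + (b + b)
      rearrange = solve-∀
    ... | inj₁ _ | inj₂ (w , small , p , _) | inj₂ (W , W∈Q , refl , W-small , _) =
      let k<u , _ = proj₁ (All.lookup settled W∈Q) refl
      in ⊥-elim (clash (size (tree W)) w fit W-small small k<u p)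
    ... | inj₁ ts≡0 | inj₁ l≡0 | inj₂ (W , W∈Q , refl , W-small , bound) =
      let k<u , bounded = proj₁ (All.lookup settled W∈Q) refl
          w = size (tree W)
      in inj₂ (w , W-small ,
           <-≤-trans k<u (+-monoˡ-≤ w (s≤s (m≤m+n _ _))) ,
           -- Each of the h′ twigs of u is at most as large as W, so k ≤ h w; by `q-least` this will
           -- give q ≤ w.
           ≤-trans (≤-pred k<u) (≤-trans (+-monoˡ-≤ w (bounded-size w ts bounded)) (≤-reflexive (+-comm (h′ * w) w))) ,
           (begin
             shortfall Q u + (wtᵀ τ ts + wtᴸ τ l)  ≡⟨ cong (_+_ (shortfall Q u)) (cong₂ _+_ ts≡0 l≡0) ⟩
             shortfall Q u + 0                     ≡⟨ +-identityʳ _ ⟩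
             shortfall Q u                         ≤⟨ bound ⟩
             children Q u * short w                ≤⟨ *-monoˡ-≤ (short w)
                                                      (few u (≤-trans (≤-reflexive (sym (δ-refl (inj₁ u)))) (m≤m+n _ _))) ⟩
             D * short w                           ∎))
      where open ≤-Reasoning
    concentrateᵀ []              _   _       _    = inj₁ refl
    concentrateᵀ (twig v e l ts) fit settled few
      with concentrateᴸ l (≤-trans (m≤m+n _ _) fit) (All.map proj₁ settled) (λ x p → few x (≤-trans p (m≤m+n _ _)))
         | concentrateᵀ ts (≤-trans (m≤n+m _ _) fit) (All.map proj₂ settled) (λ x p → few x (≤-trans p (m≤n+m _ _)))
    ... | inj₁ l≡0 | inj₁ ts≡0 = inj₁ (cong₂ _+_ l≡0 ts≡0)
    ... | inj₁ l≡0 | inj₂ (w , conc , out) =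
      inj₂ (w , widen w (m≤n+m _ _) (cong (_+ wtᵀ τ ts) l≡0) conc , λ c (_ , b) → out c b)
    ... | inj₂ (w , conc@(_ , p , _)) | inj₁ ts≡0 =
      inj₂ (w , widen w (m≤m+n _ _) (trans (cong (_+_ (wtᴸ τ l)) ts≡0) (+-identityʳ _)) conc ,
            λ c (l≤c , _) → <-≤-trans p (+-monoˡ-≤ w l≤c))
    ... | inj₂ (w , small , p , _) | inj₂ (w′ , (small′ , p′ , _) , _) =
      ⊥-elim (clash w w′ fit small small′ p p′)

    -- As B = `short w` + E w and E = D + 1, the claim D `short w` + B ≤ E s amounts to `short w` +
    -- w ≤ s, that is, to B ≤ s + D w. This is where the form of B comes from: its part k + 1 is at
    -- most s + w, and its part D′ q at most D′ w.
    concentrated⇒excess : ∀ {s t} → t ≡ 0 ⊎ ∃[ w ] Concentrated s t w → t ≤ excess s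
    concentrated⇒excess (inj₁ refl) = z≤n
    concentrated⇒excess {s} (inj₂ (w , small , k<s+w , k≤hw , t≤)) = ≤-trans t≤ (m+n≤o⇒m≤o∸n (D * short w) (begin
      D * short w + B                      ≡⟨ cong (_+_ (D * short w)) (m∸n+n≡m (<⇒≤ small)) ⟨
      D * short w + (short w + E * w)      ≡⟨ rearrange D (short w) w ⟩
      E * (short w + w)                    ≤⟨ *-monoʳ-≤ E (+-cancelʳ-≤ (D * w) (short w + w) s (begin
        short w + w + D * w    ≡⟨ +-assoc (short w) w (D * w) ⟩
        short w + E * w        ≡⟨ m∸n+n≡m (<⇒≤ small) ⟩
        suc k + D′ * q         ≤⟨ +-mono-≤ k<s+w (*-monoʳ-≤ D′ (q-least w k≤hw)) ⟩
        s + w + D′ * w         ≡⟨ +-assoc s w (D′ * w) ⟩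
        s + D * w              ∎)) ⟩
      E * s ∎))
      where
      open ≤-Reasoning
      rearrange : ∀ d a w → d * a + (a + (w + d * w)) ≡ a + w + d * (a + w)
      rearrange = solve-∀

  shorts : List Reached → ℕ
  shorts = weight (λ W → short (size (tree W)))

  inherited : List Reached → ℕ
  inherited []      = 0
  inherited (C ∷ Q) = wt (τ Q) (tree C) + inherited Q

  wt-τ : ∀ Q t → wt (τ Q) t ≡ weight (λ W → occurs t (parent W) * short (size (tree W))) Q
  wt-τ [] t = trans (sym (weight-nodes (τ []) t))
    (trans (weight-cong {f = τ []} {g = λ _ → 0} (λ { (inj₁ _) → refl ; (inj₂ _) → refl }) (nodes t))
           (weight-zero (nodes t)))
  wt-τ (W ∷ Q) t = trans (sym (weight-nodes (τ (W ∷ Q)) t))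
    (trans (weight-cong pointwise (nodes t))
    (trans (weight-+ (λ y → c * δ (inj₁ (parent W)) y) (τ Q) (nodes t))
    (cong₂ _+_ (trans (weight-* c (δ (inj₁ (parent W))) (nodes t))
                      (trans (cong (_*_ c) (weight-nodes (δ (inj₁ (parent W))) t)) (*-comm c _)))
               (trans (weight-nodes (τ Q) t) (wt-τ Q t)))))
    where
    c = short (size (tree W))
    pointwise : ∀ y → τ (W ∷ Q) y ≡ c * δ (inj₁ (parent W)) y + τ Q y
    pointwise (inj₁ u) = cong (_+ shortfall Q u) (*-comm (indicator (parent W ≟ u)) c)
    pointwise (inj₂ _) = sym (trans (+-identityʳ _) (*-zeroʳ c))

  -- Validity puts the parent of each tree either among the vertices counted by e or into an earlier
  -- tree of the list, so grouping the trees by their parents loses none.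
  shorts-by-parent : ∀ e P → Valid e P →
    shorts P ≤ weight (λ W → e (parent W) * short (size (tree W))) P + inherited P
  shorts-by-parent e []      _              = z≤n
  shorts-by-parent e (C ∷ P) (seen , valid) = begin
    c + shorts P
      ≤⟨ +-mono-≤ (≤-trans (≤-reflexive (sym (*-identityˡ c))) (*-monoˡ-≤ c seen)) (shorts-by-parent _ P valid) ⟩
    e (parent C) * c + (weight (λ W → (e (parent W) + occurs (tree C) (parent W)) * short (size (tree W))) P + inherited P)
      ≡⟨ cong (λ a → e (parent C) * c + (a + inherited P))
           (trans (weight-cong (λ W → *-distribʳ-+ (short (size (tree W))) (e (parent W)) (occurs (tree C) (parent W))) P)
                  (weight-+ (λ W → e (parent W) * short (size (tree W))) _ P)) ⟩
    e (parent C) * c + (X + weight (λ W → occurs (tree C) (parent W) * short (size (tree W))) P + inherited P)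
      ≡⟨ cong (λ a → e (parent C) * c + (X + a + inherited P)) (wt-τ P (tree C)) ⟨
    e (parent C) * c + (X + wt (τ P) (tree C) + inherited P)
      ≡⟨ rearrange (e (parent C) * c) X _ _ ⟩
    e (parent C) * c + X + (wt (τ P) (tree C) + inherited P) ∎
    where
    open ≤-Reasoning
    c = short (size (tree C))
    X = weight (λ W → e (parent W) * short (size (tree W))) P
    rearrange : ∀ a b c d → a + (b + c + d) ≡ a + b + (c + d)
    rearrange = solve-∀

  neighbours : Fin m → Vertex m n → ℕ
  neighbours u = rightWeight (λ v → indicator (v ∈? G u))

  children≤neighbours : ∀ Q u → children Q u ≤ wtᴿ (neighbours u) Q
  children≤neighbours []      u = z≤n
  children≤neighbours (W ∷ Q) u =
    +-mono-≤ (≤-trans (indicator-mono (parent W ≟ u)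
                        (λ { refl → ≤-reflexive (sym (indicator-yes (root W ∈? G u) (link W))) }))
                      (m≤m+n (indicator (root W ∈? G u)) _))
             (children≤neighbours Q u)

  degree-in-tree : ∀ u t → 1 ≤ occurs t u → suc h′ ≤ wt (neighbours u) t
  degree-in-tree u (v , l) = covered-degreeᴸ u (λ v → indicator (v ∈? G u)) 0 l
    λ { {w} (inj₁ p) → ≤-reflexive (sym (indicator-yes (w ∈? G u) (edges-soundᴸ 0 l p)))
      ; {w} (inj₂ p) → ≤-reflexive (sym (indicator-yes (w ∈? G u) (edges-soundᴸ 0 l p))) }

  excesses : List Reached → ℕ
  excesses = weight (λ W → excess (size (tree W)))

  inherited≤excesses : ∀ P → (∀ u → wtᴿ (neighbours u) P ≤ suc h′ + D) → All Fits (map tree P) → Settled P →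
                       inherited P ≤ excesses P
  inherited≤excesses []      _   _            _                     = z≤n
  inherited≤excesses (C ∷ P) deg (fit ∷ fits) (settled , settled′) =
    +-mono-≤ (concentrated⇒excess P (concentrateᴸ P (limbs C) fit settled few))
             (inherited≤excesses P (λ u → ≤-trans (m≤n+m _ _) (deg u)) fits settled′)
    where
    -- Of the at most h + D neighbours of u, h lie in C itself; the roots of the trees entered from
    -- u are further neighbours, in later trees.
    few : AtMostD P (λ f → wtᴸ f (limbs C))
    few u occ = +-cancelˡ-≤ (suc h′) _ _
      (≤-trans (+-mono-≤ (degree-in-tree u (tree C) occ) (children≤neighbours P u)) (deg u))

  -- If c is not short, neither are the `zs`, and each of the h′ entries of `ys` lacks at most B. If
  -- c is short, then c and `ys` lack exactly h B - E (their total size) ≤ h B - E k. Moreover k ≤ h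
  -- (s c) gives s c ≥ q, so the at most D entries of `zs` lack at most `short q` each, and B + D
  -- `short q` = E (`short q` + q) ≤ E k.
  few-short : ∀ (s : A → ℕ) c ys zs → length ys ≡ h′ → length zs ≤ D →
              All (λ y → s y ≤ s c) ys → All (λ z → s c ≤ s z) zs → k ≤ s c + weight s ys →
              weight (short ∘ s) (c ∷ (ys ++ zs)) ≤ h′ * B
  few-short s c ys zs refl zs≤D ys≤c c≤zs k≤ with B ≤? E * s c
  ... | yes B≤c = begin
    short (s c) + weight (short ∘ s) (ys ++ zs)
      ≡⟨ cong₂ _+_ (m≤n⇒m∸n≡0 B≤c) (weight-++ (short ∘ s) ys zs) ⟩
    weight (short ∘ s) ys + weight (short ∘ s) zs
      ≤⟨ +-mono-≤ (weight-≤ (short ∘ s) B {ys} (All.tabulate (λ {y} _ → m∸n≤m B (E * s y))))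
                  (weight-≤ (short ∘ s) 0 (All.map (λ p → ≤-reflexive (m≤n⇒m∸n≡0 (≤-trans B≤c (*-monoʳ-≤ E p)))) c≤zs)) ⟩
    length ys * B + length zs * 0
      ≡⟨ trans (cong (_+_ (length ys * B)) (*-zeroʳ (length zs))) (+-identityʳ _) ⟩
    length ys * B ∎
    where open ≤-Reasoning
  ... | no B≰c = +-cancelʳ-≤ (E * k) _ _ (begin
    short (s c) + weight (short ∘ s) (ys ++ zs) + E * k
      ≤⟨ +-monoʳ-≤ (short (s c) + weight (short ∘ s) (ys ++ zs)) (*-monoʳ-≤ E k≤) ⟩
    short (s c) + weight (short ∘ s) (ys ++ zs) + E * (s c + weight s ys)
      ≡⟨ cong (λ a → short (s c) + a + E * (s c + weight s ys)) (weight-++ (short ∘ s) ys zs) ⟩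
    short (s c) + (weight (short ∘ s) ys + weight (short ∘ s) zs) + E * (s c + weight s ys)
      ≡⟨ rearrange₁ (short (s c)) (weight (short ∘ s) ys) (weight (short ∘ s) zs) E (s c) (weight s ys) ⟩
    short (s c) + E * s c + (weight (short ∘ s) ys + E * weight s ys) + weight (short ∘ s) zs
      ≡⟨ cong₂ (λ a b → a + b + weight (short ∘ s) zs) (m∸n+n≡m c≤B) ys-short ⟩
    B + length ys * B + weight (short ∘ s) zs
      ≤⟨ +-monoʳ-≤ (B + length ys * B) (≤-trans (weight-≤ (short ∘ s) (short q)
           (All.map (λ p → ∸-monoʳ-≤ B (*-monoʳ-≤ E (≤-trans q≤c p))) c≤zs)) (*-monoˡ-≤ (short q) zs≤D)) ⟩
    B + length ys * B + D * short q
      ≡⟨ cong (λ a → a + length ys * B + D * short q) (m∸n+n≡m Eq≤B) ⟨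
    short q + E * q + length ys * B + D * short q
      ≡⟨ rearrange₂ (short q) q (length ys * B) D ⟩
    length ys * B + E * (short q + q)
      ≤⟨ +-monoʳ-≤ (length ys * B) (*-monoʳ-≤ E (small-threshold (short q) Eq≤B refl)) ⟩
    length ys * B + E * k ∎)
    where
    open ≤-Reasoning
    c≤B : E * s c ≤ B
    c≤B = <⇒≤ (≰⇒> B≰c)
    q≤c : q ≤ s c
    q≤c = q-least (s c) (≤-trans k≤ (+-monoʳ-≤ (s c) (weight-≤ s (s c) ys≤c)))
    Eq≤B : E * q ≤ B
    Eq≤B = ≤-trans (*-monoʳ-≤ E q≤c) c≤B
    ys-short : weight (short ∘ s) ys + E * weight s ys ≡ length ys * B
    ys-short = small-sum ys ys≤c
      where
      small-sum : ∀ xs → All (λ x → s x ≤ s c) xs → weight (short ∘ s) xs + E * weight s xs ≡ length xs * B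
      small-sum []       []       = *-zeroʳ E
      small-sum (x ∷ xs) (p ∷ ps) =
        trans (rearrange (short (s x)) _ E (s x) _) (cong₂ _+_ (m∸n+n≡m (≤-trans (*-monoʳ-≤ E p) c≤B)) (small-sum xs ps))
        where
        rearrange : ∀ a b e x y → a + b + e * (x + y) ≡ a + e * x + (b + e * y)
        rearrange = solve-∀
    rearrange₁ : ∀ a b z e c y → a + (b + z) + e * (c + y) ≡ a + e * c + (b + e * y) + z
    rearrange₁ = solve-∀
    rearrange₂ : ∀ a q l d → a + (q + d * q) + l + d * a ≡ l + (a + q + d * (a + q))
    rearrange₂ = solve-∀

-- Augmenting the forest by one left vertex.

module Augmentation {m n : ℕ} (G : BipartiteGraph m n) (h′ k D′ q : ℕ)
  (q-positive : 1 ≤ q) (2q≤1+k : q + q ≤ suc k) (q-least : ∀ w → k ≤ suc h′ * w → q ≤ w)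
  (degree≤ : ∀ u → degree G u ≤ suc h′ + suc D′)
  (expands : ∀ S → ((suc k + D′ * q) * h′ + suc (suc D′)) * ∣ S ∣ ≤ (suc k + D′ * q) * ∣ Γ G S ∣) where
  open Counting G h′ k D′ q q-positive 2q≤1+k q-least public

  detach : ∀ v Φ → All Fits Φ → 1 ≤ wtᶠ (δ (inj₂ v)) Φ →
           Σ[ l ∈ Limbs v ] Σ[ Ψ ∈ Forest ]
             (size (v , l) ≤ k × All Fits Ψ × (∀ f → wtᶠ f Φ ≡ wt f (v , l) + wtᶠ f Ψ))
  detach v (t ∷ Φ) (fit ∷ fits) p with +-positive (wt (δ (inj₂ v)) t) p
  ... | inj₁ r =
    let l , eq = reroot t v r
    in l , Φ , subst (_≤ k) (sym (eq onLeft)) fit , fits , λ f → cong (_+ wtᶠ f Φ) (sym (eq f))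
  ... | inj₂ r =
    let l , Ψ , fit′ , fits′ , eq = detach v Φ fits r
    in l , t ∷ Ψ , fit′ , fit ∷ fits′ ,
       λ f → trans (cong (_+_ (wt f t)) (eq f)) (exchange (wt f t) (wt f (v , l)) (wtᶠ f Ψ))
    where
    exchange : ∀ (a b c : ℕ) → a + (b + c) ≡ b + (a + c)
    exchange = solve-∀

  module _ (u : Fin m) where

    Child : Set
    Child = Σ[ v ∈ Fin n ] (v ∈ G u × Limbs v)

    childTree : Child → Tree
    childTree (v , _ , l) = v , l

    childSize : Child → ℕ
    childSize c = size (childTree c)

    record Split (P : List Reached) : Set where
      field
        below    : List Child
        others   : Forest
        fits     : All Fits (map childTree below)
        fits′    : All Fits others
        conserve : ∀ f → wtᴿ f P ≡ weight (λ c → wt f (childTree c)) below + wtᶠ f others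
        count    : length below ≡ children P u
        deficit  : weight (short ∘ childSize) below ≡ shortfall P u

    split : ∀ P → All Fits (map tree P) → Split P
    split []      []           = record
      { below = [] ; others = [] ; fits = [] ; fits′ = [] ; conserve = λ _ → refl ; count = refl ; deficit = refl }
    split (W ∷ P) (fit ∷ fits) with parent W ≟ u
    ... | yes W≡u@refl = record
      { below    = (root W , link W , limbs W) ∷ S.below
      ; others   = S.others
      ; fits     = fit ∷ S.fits
      ; fits′    = S.fits′
      ; conserve = λ f → trans (cong (_+_ (wt f (tree W))) (S.conserve f)) (sym (+-assoc (wt f (tree W)) _ _))
      ; count    = cong₂ _+_ (sym (indicator-yes (parent W ≟ u) W≡u)) S.count
      ; deficit  = cong₂ _+_ (trans (sym (*-identityˡ _)) (cong (_* short (size (tree W)))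
                     (sym (indicator-yes (parent W ≟ u) W≡u)))) S.deficit
      }
      where module S = Split (split P fits)
    ... | no W≢u = record
      { below    = S.below
      ; others   = tree W ∷ S.others
      ; fits     = S.fits
      ; fits′    = fit ∷ S.fits′
      ; conserve = λ f → trans (cong (_+_ (wt f (tree W))) (S.conserve f))
                     (exchange (wt f (tree W)) (weight (λ c → wt f (childTree c)) S.below) (wtᶠ f S.others))
      ; count    = cong₂ _+_ (sym (indicator-no (parent W ≟ u) W≢u)) S.count
      ; deficit  = cong₂ _+_ (cong (_* short (size (tree W))) (sym (indicator-no (parent W ≟ u) W≢u))) S.deficit
      }
      where
      module S = Split (split P fits)
      exchange : ∀ (a b c : ℕ) → a + (b + c) ≡ b + (a + c)
      exchange = solve-∀

    toTwigs : (cs : List Child) → Twigs u (length cs)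
    toTwigs []                 = []
    toTwigs ((v , e , l) ∷ cs) = twig v e l (toTwigs cs)

    wt-toTwigs : ∀ f cs → wtᵀ f (toTwigs cs) ≡ weight (λ c → wt f (childTree c)) cs
    wt-toTwigs f []       = refl
    wt-toTwigs f (c ∷ cs) = cong (_+_ (wt f (childTree c))) (wt-toTwigs f cs)

    join : (c : Child) (ys : List Child) → length ys ≡ h′ → Tree
    join (v , e , l) ys len = v , limb u e (castᵀ len (toTwigs ys)) l

    wt-join : ∀ f c ys (len : length ys ≡ h′) →
              wt f (join c ys len) ≡ f (inj₁ u) + (wt f (childTree c) + weight (λ y → wt f (childTree y)) ys)
    wt-join f (v , e , l) ys len =
      trans (cong (λ a → f (inj₂ v) + (f (inj₁ u) + (a + wtᴸ f l)))
                  (trans (wt-castᵀ f len (toTwigs ys)) (wt-toTwigs f ys)))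
            (rearrange (f (inj₂ v)) (f (inj₁ u)) _ (wtᴸ f l))
      where
      rearrange : ∀ a b c d → a + (b + (c + d)) ≡ b + (a + d + c)
      rearrange = solve-∀

    -- The strict inequality leaves room for u itself in the new tree.
    Attachable : List Child → Set
    Attachable cs = ∃[ c ] ∃[ ys ] ∃[ zs ]
      (cs ↭ c ∷ (ys ++ zs) × length ys ≡ h′ × childSize c + weight childSize ys < k)

    attachable? : ∀ cs → length cs ≤ suc h′ + D → Attachable cs ⊎ weight (short ∘ childSize) cs ≤ h′ * B
    attachable? cs cs≤ with h′ <? length cs
    -- With at most h′ trees entered from u the bound is immediate, as no tree lacks more than B.
    ... | no h′≮ = inj₂ (≤-trans (weight-≤ (short ∘ childSize) B {cs} (All.tabulate (λ {c} _ → m∸n≤m B (E * childSize c))))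
                                 (*-monoˡ-≤ B (≮⇒≥ h′≮)))
    ... | yes h′< with select childSize h′ cs h′<
    ...   | ys , c , zs , p , len , ys≤c , c≤zs with childSize c + weight childSize ys <? k
    ...     | yes fit = inj₁ (c , ys , zs , p , len , fit)
    ...     | no  big = inj₂ (≤-trans (≤-reflexive (weight-↭ (short ∘ childSize) p))
                                      (few-short childSize c ys zs len zs≤D ys≤c c≤zs (≮⇒≥ big)))
      where
      zs≤D : length zs ≤ D
      zs≤D = +-cancelˡ-≤ (suc h′) _ _ (≤-trans (≤-reflexive (sym
        (trans (↭-length p) (trans (cong suc (length-++ ys)) (cong (λ a → suc (a + length zs)) len))))) cs≤)

    module _ (us : List (Fin m)) (unique : Unique (u ∷ us)) where

      record State : Set where
        field
          explored : List Reached
          rest     : Forest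
          valid    : Valid (λ x → indicator (x ≟ u)) explored
          fits     : All Fits (map tree explored)
          fits′    : All Fits rest
          conserve : ∀ f → wtᴿ f explored + wtᶠ f rest ≡ total us f

        wt≤total : ∀ f → wtᴿ f explored ≤ total us f
        wt≤total f = ≤-trans (m≤m+n _ _) (≤-reflexive (conserve f))

        size-explored : ℕ
        size-explored = weight size (map tree explored)

        right-explored : wtᴿ onRight explored ≡ length explored + h′ * size-explored
        right-explored = trans (sym (weight-map-tree onRight explored))
          (trans (weight-onRight-forest (map tree explored))
                 (cong (_+ h′ * size-explored) (length-map tree explored)))

        explored≤n : length explored ≤ n
        explored≤n = begin
          length explored                       ≤⟨ m≤m+n _ _ ⟩
          length explored + h′ * size-explored  ≡⟨ right-explored ⟨
          wtᴿ onRight explored                  ≤⟨ wt≤total onRight ⟩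
          ∑ {n} (λ _ → 1) + weight (λ _ → 0) us ≡⟨ cong₂ _+_ (trans (∑-const n 1) (*-identityʳ n)) (weight-zero us) ⟩
          n + 0                                 ≡⟨ +-identityʳ n ⟩
          n                                     ∎
          where open ≤-Reasoning

        degree-explored : ∀ x → wtᴿ (neighbours x) explored ≤ suc h′ + D
        degree-explored x = begin
          wtᴿ (neighbours x) explored                    ≤⟨ wt≤total (neighbours x) ⟩
          ∑ (λ v → indicator (v ∈? G x)) + weight (λ _ → 0) us
            ≡⟨ cong₂ _+_ (sym (∣∣≡∑ (G x))) (weight-zero us) ⟩
          ∣ G x ∣ + 0                                    ≡⟨ +-identityʳ _ ⟩
          ∣ G x ∣                                        ≤⟨ degree≤ x ⟩
          suc h′ + D                                     ∎
          where open ≤-Reasoning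

        reach : Fin m → ℕ
        reach x = indicator (x ≟ u) + wtᴿ (δ (inj₁ x)) explored

        reach≤1 : ∀ x → reach x ≤ 1
        reach≤1 x = begin
          indicator (x ≟ u) + wtᴿ (δ (inj₁ x)) explored
            ≤⟨ +-monoʳ-≤ (indicator (x ≟ u)) (wt≤total (δ (inj₁ x))) ⟩
          indicator (x ≟ u) + (∑ {n} (λ _ → 0) + weight (λ y → indicator (x ≟ y)) us)
            ≡⟨ cong (λ a → indicator (x ≟ u) + (a + weight (λ y → indicator (x ≟ y)) us))
                 (trans (∑-const n 0) (*-zeroʳ n)) ⟩
          weight (λ y → indicator (x ≟ y)) (u ∷ us)  ≤⟨ unique-count x unique ⟩
          1                                          ∎
          where open ≤-Reasoning

        Escape : Fin m → Fin n → Set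
        Escape x v = 1 ≤ reach x × v ∈ G x × wtᴿ (δ (inj₂ v)) explored ≡ 0

        escape? : Dec (∃[ x ] ∃[ v ] Escape x v)
        escape? = any? λ x → any? λ v →
          (1 ≤? reach x) ×-dec (v ∈? G x) ×-dec (wtᴿ (δ (inj₂ v)) explored ≟ℕ 0)

        balance : ∀ P → E * weight size (map tree P) + shorts P ≡ B * length P + excesses P
        balance []      = cong₂ _+_ (trans (*-zeroʳ E) (sym (*-zeroʳ B))) refl
        balance (W ∷ P) = trans (rearrange₁ E (size (tree W)) _ (short (size (tree W))) (shorts P))
          (trans (cong₂ _+_ (short-excess (size (tree W))) (balance P))
                 (rearrange₂ B (excess (size (tree W))) (length P) (excesses P)))
          where
          rearrange₁ : ∀ e a b c d → e * (a + b) + (c + d) ≡ e * a + c + (e * b + d)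
          rearrange₁ = solve-∀
          rearrange₂ : ∀ b x l y → b + x + (b * l + y) ≡ b * (1 + l) + (x + y)
          rearrange₂ = solve-∀

        module _ (closed : ¬ (∃[ x ] ∃[ v ] Escape x v)) where

          seen : Subset m
          seen = Vec.tabulate (λ x → does (1 ≤? reach x))

          -- By `reach≤1` no left vertex is met twice, so occurrences count distinct vertices of
          -- `seen`; the additional one is u.
          seen-large : suc size-explored ≤ ∣ seen ∣
          seen-large = begin
            1 + size-explored
              ≡⟨ cong₂ _+_ (sym (∑-indicator u)) (sym (∑-wt-left (map tree explored))) ⟩
            ∑ (λ x → indicator (x ≟ u)) + ∑ (λ x → wtᶠ (δ (inj₁ x)) (map tree explored))
              ≡⟨ ∑-distrib-+ (λ x → indicator (x ≟ u)) _ ⟨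
            ∑ (λ x → indicator (x ≟ u) + wtᶠ (δ (inj₁ x)) (map tree explored))
              ≤⟨ ∑-mono bound ⟩
            ∑ (λ x → indicator (x ∈? seen))
              ≡⟨ ∣∣≡∑ seen ⟨
            ∣ seen ∣ ∎
            where
            open ≤-Reasoning
            bound : ∀ x → indicator (x ≟ u) + wtᶠ (δ (inj₁ x)) (map tree explored) ≤ indicator (x ∈? seen)
            bound x rewrite weight-map-tree (δ (inj₁ x)) explored with 1 ≤? reach x
            ... | yes p = ≤-trans (reach≤1 x)
                            (≤-reflexive (sym (indicator-yes (x ∈? seen) (∈-tabulate⁺ (λ x → 1 ≤? reach x) p))))
            ... | no ¬p = ≤-trans (≤-pred (≰⇒> ¬p)) z≤n

          Γ-small : ∣ Γ G seen ∣ ≤ length explored + h′ * size-explored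
          Γ-small = begin
            ∣ Γ G seen ∣
              ≡⟨ ∣∣≡∑ (Γ G seen) ⟩
            ∑ (λ v → indicator (v ∈? Γ G seen))
              ≤⟨ ∑-mono (λ v → indicator-mono (v ∈? Γ G seen) (reached-neighbour v)) ⟩
            ∑ (λ v → wtᶠ (δ (inj₂ v)) (map tree explored))
              ≡⟨ ∑-wt-right (map tree explored) ⟩
            wtᶠ onRight (map tree explored)
              ≡⟨ trans (weight-map-tree onRight explored) right-explored ⟩
            length explored + h′ * size-explored ∎
            where
            open ≤-Reasoning
            reached-neighbour : ∀ v → v ∈ Γ G seen → 1 ≤ wtᶠ (δ (inj₂ v)) (map tree explored)
            reached-neighbour v v∈ with ∈-tabulate⁻ (λ v → any? λ u → (u ∈? seen) ×-dec (v ∈? G u)) v∈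
            ... | x , x∈seen , v∈Gx rewrite weight-map-tree (δ (inj₂ v)) explored =
              n≢0⇒n>0 (λ eq → closed (x , v , ∈-tabulate⁻ (λ x → 1 ≤? reach x) x∈seen , v∈Gx , eq))

          closed-contradiction : Settled explored → shortfall explored u ≤ h′ * B → ⊥
          -- The two bounds on `B * length explored` differ by E, the share of u, which is seen but
          -- lies in no explored tree.
          closed-contradiction settled deficit = m+1+n≰m (B * h′ + E * N) (begin
            B * h′ + E * N + E                ≤⟨ +-cancelˡ-≤ (B * h′ * N) _ _ expansion-bound ⟩
            B * length explored               ≤⟨ +-cancelʳ-≤ (excesses explored) _ _ upper ⟩
            B * h′ + E * N                    ∎)
            where
            open ≤-Reasoning
            N = size-explored
            upper : B * length explored + excesses explored ≤ B * h′ + E * N + excesses explored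
            upper = begin
              B * length explored + excesses explored
                ≡⟨ balance explored ⟨
              E * N + shorts explored
                ≤⟨ +-monoʳ-≤ (E * N) (shorts-by-parent _ explored valid) ⟩
              E * N + (shortfall explored u + inherited explored)
                ≤⟨ +-monoʳ-≤ (E * N) (+-mono-≤ deficit (inherited≤excesses explored degree-explored fits settled)) ⟩
              E * N + (h′ * B + excesses explored)
                ≡⟨ rearrange (E * N) h′ B (excesses explored) ⟩
              B * h′ + E * N + excesses explored ∎
              where
              rearrange : ∀ a h b x → a + (h * b + x) ≡ b * h + a + x
              rearrange = solve-∀
            expansion-bound : B * h′ * N + (B * h′ + E * N + E) ≤ B * h′ * N + B * length explored
            expansion-bound = begin
              B * h′ * N + (B * h′ + E * N + E)  ≡⟨ rearrange₁ (B * h′) E N ⟩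
              (B * h′ + E) * suc N               ≤⟨ *-monoʳ-≤ (B * h′ + E) seen-large ⟩
              (B * h′ + E) * ∣ seen ∣            ≤⟨ expands seen ⟩
              B * ∣ Γ G seen ∣                   ≤⟨ *-monoʳ-≤ B Γ-small ⟩
              B * (length explored + h′ * N)     ≡⟨ rearrange₂ B (length explored) h′ N ⟩
              B * h′ * N + B * length explored   ∎
              where
              rearrange₁ : ∀ a e x → a * x + (a + e * x + e) ≡ (a + e) * (1 + x)
              rearrange₁ = solve-∀
              rearrange₂ : ∀ b l h x → b * (l + h * x) ≡ b * h * x + b * l
              rearrange₂ = solve-∀

      open State

      attach : ∀ s (sp : Split (explored s)) → Attachable (Split.below sp) → ∃[ Φ ] Spanning (u ∷ us) Φ
      attach s sp (c , ys , zs , p , len , small) =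
        join c ys len ∷ map childTree zs ++ others ++ rest s ,
        (subst (_≤ k) (sym (wt-join onLeft c ys len)) small ∷
         ++⁺ ((++⁻ʳ (map childTree ys)
               (subst (All Fits) (map-++ childTree ys zs) (All.tail (All-resp-↭ (map⁺ childTree p) sp.fits)))))
             (++⁺ sp.fits′ (fits′ s))) ,
        λ f → begin
          wt f (join c ys len) + wtᶠ f (map childTree zs ++ others ++ rest s)
            ≡⟨ cong₂ _+_ (wt-join f c ys len)
                 (trans (weight-++ (wt f) (map childTree zs) _)
                        (cong₂ _+_ (weight-map f zs) (weight-++ (wt f) others (rest s)))) ⟩
          f (inj₁ u) + (wt f (childTree c) + wtᶜ f ys) + (wtᶜ f zs + (wtᶠ f others + wtᶠ f (rest s)))
            ≡⟨ rearrange (f (inj₁ u)) (wt f (childTree c)) (wtᶜ f ys) (wtᶜ f zs) (wtᶠ f others) (wtᶠ f (rest s)) ⟩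
          f (inj₁ u) + (wt f (childTree c) + (wtᶜ f ys + wtᶜ f zs) + wtᶠ f others + wtᶠ f (rest s))
            ≡⟨ cong (λ a → f (inj₁ u) + (a + wtᶠ f others + wtᶠ f (rest s)))
                 (trans (weight-↭ (λ c → wt f (childTree c)) p)
                        (cong (_+_ (wt f (childTree c))) (weight-++ (λ c → wt f (childTree c)) ys zs))) ⟨
          f (inj₁ u) + (wtᶜ f below + wtᶠ f others + wtᶠ f (rest s))
            ≡⟨ cong (λ a → f (inj₁ u) + (a + wtᶠ f (rest s))) (sp.conserve f) ⟨
          f (inj₁ u) + (wtᴿ f (explored s) + wtᶠ f (rest s))
            ≡⟨ cong (_+_ (f (inj₁ u))) (conserve s f) ⟩
          f (inj₁ u) + total us f
            ≡⟨ exchange (f (inj₁ u)) (∑ (λ v → f (inj₂ v))) _ ⟩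
          total (u ∷ us) f ∎
        where
        open ≡-Reasoning
        module sp = Split sp
        open Split sp using (below; others)
        wtᶜ : (Vertex m n → ℕ) → List Child → ℕ
        wtᶜ f = weight (λ c → wt f (childTree c))
        weight-map : ∀ f cs → wtᶠ f (map childTree cs) ≡ wtᶜ f cs
        weight-map f []       = refl
        weight-map f (c ∷ cs) = cong (_+_ (wt f (childTree c))) (weight-map f cs)
        exchange : ∀ (a b c : ℕ) → a + (b + c) ≡ b + (a + c)
        exchange = solve-∀
        rearrange : ∀ x c y z o r → x + (c + y) + (z + (o + r)) ≡ x + (c + (y + z) + o + r)
        rearrange = solve-∀

      search : ∀ s → Acc _<_ (rank n (explored s)) → ∃[ Φ ] Spanning (u ∷ us) Φ
      search s (acc rec) with progress _ n (explored s) (explored≤n s) (valid s) (fits s)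
      ... | inj₂ p = search record
        { explored = P.explored
        ; rest     = P.discarded ++ rest s
        ; valid    = P.valid
        ; fits     = P.fits
        ; fits′    = ++⁺ P.fits′ (fits′ s)
        ; conserve = λ f → trans (cong (_+_ (wtᴿ f P.explored)) (weight-++ (wt f) P.discarded (rest s)))
            (trans (sym (+-assoc (wtᴿ f P.explored) _ _))
            (trans (cong (_+ wtᶠ f (rest s)) (sym (P.conserve f))) (conserve s f)))
        } (rec P.decrease)
        where module P = Progress p
      ... | inj₁ settled with escape? s
      ...   | yes (x , v , seen-x , v∈Gx , fresh) = search s′ (rec (append-rank n (explored s) W bound fit))
        where
        present : 1 ≤ wtᶠ (δ (inj₂ v)) (rest s)
        present = begin
          1                                    ≡⟨ δ-refl (inj₂ v) ⟨
          δ (inj₂ v) (inj₂ v)                  ≤⟨ term≤∑ (λ w → δ (inj₂ v) (inj₂ w)) v ⟩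
          ∑ (λ w → δ (inj₂ v) (inj₂ w))        ≤⟨ m≤m+n _ _ ⟩
          total us (δ (inj₂ v))                ≡⟨ conserve s (δ (inj₂ v)) ⟨
          wtᴿ (δ (inj₂ v)) (explored s) + wtᶠ (δ (inj₂ v)) (rest s) ≡⟨ cong (_+ wtᶠ (δ (inj₂ v)) (rest s)) fresh ⟩
          wtᶠ (δ (inj₂ v)) (rest s)            ∎
          where open ≤-Reasoning
        found = detach v (rest s) (fits′ s) present
        Ψ     = proj₁ (proj₂ found)
        fit   = proj₁ (proj₂ (proj₂ found))
        W : Reached
        W = reached v∈Gx (proj₁ found)
        s′ : State
        s′ = record
          { explored = explored s ++ W ∷ []
          ; rest     = Ψ
          ; valid    = append-valid _ (explored s) W (valid s) seen-x
          ; fits     = subst (All Fits) (sym (map-++ tree (explored s) (W ∷ []))) (++⁺ (fits s) (fit ∷ []))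
          ; fits′    = proj₁ (proj₂ (proj₂ (proj₂ found)))
          ; conserve = λ f → trans (cong (_+ wtᶠ f Ψ) (weight-++ (λ W → wt f (tree W)) (explored s) (W ∷ [])))
              (trans (rearrange (wtᴿ f (explored s)) (wt f (tree W)) (wtᶠ f Ψ))
              (trans (cong (_+_ (wtᴿ f (explored s))) (sym (proj₂ (proj₂ (proj₂ (proj₂ found))) f))) (conserve s f)))
          }
          where
          rearrange : ∀ (a b c : ℕ) → a + (b + 0) + c ≡ a + (b + c)
          rearrange = solve-∀
        -- Each tree of the extended state has its own root among the n right vertices, so a rank
        -- with n digits still has a place for W.
        bound : length (explored s) < n
        bound = subst (_≤ n) (trans (length-++ (explored s)) (+-comm (length (explored s)) 1)) (explored≤n s′)
      ...   | no closed with attachable? (Split.below sp) count≤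
        where
        sp = split (explored s) (fits s)
        count≤ : length (Split.below sp) ≤ suc h′ + D
        count≤ = ≤-trans (≤-reflexive (Split.count sp))
          (≤-trans (children≤neighbours (explored s) u) (degree-explored s u))
      ...     | inj₁ attachable = attach s (split (explored s) (fits s)) attachable
      ...     | inj₂ deficit    = ⊥-elim (closed-contradiction s closed settled
        (subst (_≤ h′ * B) (Split.deficit (split (explored s) (fits s))) deficit))

  spanning : ∀ us → Unique us → ∃[ Φ ] Spanning us Φ
  spanning [] _ = map (λ v → v , []) (allFin n) ,
    singletons-fit (allFin n) ,
    λ f → trans (singletons f (allFin n)) (trans (weight-allFin (λ v → f (inj₂ v))) (sym (+-identityʳ _)))
    where
    singletons-fit : ∀ vs → All Fits (map (λ v → v , []) vs)
    singletons-fit []       = []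
    singletons-fit (_ ∷ vs) = z≤n ∷ singletons-fit vs
    singletons : ∀ f vs → wtᶠ f (map (λ v → v , []) vs) ≡ weight (λ v → f (inj₂ v)) vs
    singletons f []       = refl
    singletons f (v ∷ vs) = cong₂ _+_ (+-identityʳ _) (singletons f vs)
    weight-tabulate : ∀ {j} (f : Fin n → ℕ) (g : Fin j → Fin n) → weight f (tabulate g) ≡ ∑ (f ∘ g)
    weight-tabulate {zero}  f g = refl
    weight-tabulate {suc j} f g = cong (_+_ (f (g zero))) (weight-tabulate f (g ∘ suc))
    weight-allFin : ∀ (f : Fin n → ℕ) → weight f (allFin n) ≡ ∑ f
    weight-allFin f = weight-tabulate f (λ i → i)
  spanning (u ∷ us) unique@(_ ∷ unique′) with spanning us unique′
  ... | Φ , fits , eq = search u us unique record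
    { explored = [] ; rest = Φ ; valid = tt ; fits = [] ; fits′ = fits ; conserve = eq } (<-wellFounded _)

-- Absence of cycles from depths and unique parents.

weight-unique : ∀ (f : A → ℕ) {xs x y} → weight f xs ≤ 1 → x ∈ˡ xs → y ∈ˡ xs → 1 ≤ f x → 1 ≤ f y → x ≡ y
weight-unique f           ≤1 (here refl) (here refl) _ _ = refl
weight-unique f           ≤1 (here refl) (there y∈)  p q =
  contradiction (≤-trans (+-mono-≤ p (≤-trans q (weight-∈ f y∈))) ≤1) λ { (s≤s ()) }
weight-unique f           ≤1 (there x∈)  (here refl) p q =
  contradiction (≤-trans (+-mono-≤ q (≤-trans p (weight-∈ f x∈))) ≤1) λ { (s≤s ()) }
weight-unique f {w ∷ xs} ≤1 (there x∈)  (there y∈)  p q =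
  weight-unique f (≤-trans (m≤n+m _ (f w)) ≤1) x∈ y∈ p q

weight-mono : ∀ {f g : A → ℕ} → (∀ x → f x ≤ g x) → ∀ xs → weight f xs ≤ weight g xs
weight-mono f≤g []       = z≤n
weight-mono f≤g (x ∷ xs) = +-mono-≤ (f≤g x) (weight-mono f≤g xs)

NonBacktracking : List A → Set
NonBacktracking (a ∷ b ∷ c ∷ xs) = a ≢ c × NonBacktracking (b ∷ c ∷ xs)
NonBacktracking _                = ⊤

-- The cycle is walked around once and its initial edge is then repeated, so that backtracking is
-- also excluded at the starting vertex.
nonBacktracking-wrap : ∀ {x y : A} a b zs → Unique (a ∷ b ∷ zs) → All (_≢ x) (a ∷ b ∷ zs) → All (_≢ y) (b ∷ zs) →
                       NonBacktracking (a ∷ b ∷ (zs ++ x ∷ y ∷ []))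
nonBacktracking-wrap a b []       _                        (a≢x ∷ _)  (b≢y ∷ _)  = a≢x , b≢y , tt
nonBacktracking-wrap a b (c ∷ zs) ((_ ∷ a≢c ∷ _) ∷ unique) (_ ∷ rest) (_ ∷ rest′) =
  a≢c , nonBacktracking-wrap b c zs unique rest rest′

linked-wrap : ∀ {R : A → A → Set} xs {x y} → Linked R (xs ∷ʳ x) → R x y → Linked R (xs ++ x ∷ y ∷ [])
linked-wrap []           _         r = r ∷ [-]
linked-wrap (a ∷ [])     (p ∷ _)   r = p ∷ r ∷ [-]
linked-wrap (a ∷ b ∷ xs) (p ∷ ps)  r = p ∷ linked-wrap (b ∷ xs) ps r

-- A closed walk without backtracking that once goes down an edge never goes up
-- again, so its depths cannot return to the initial one.
module Descent {A : Set} (Arc : A → A → ℕ → Set) (Depth : A → ℕ → Set)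
  (source : ∀ {a b i} → Arc a b i → Depth a i) (target : ∀ {a b i} → Arc a b i → Depth b (suc i))
  (depth-unique : ∀ {a i j} → Depth a i → Depth a j → i ≡ j)
  (parent-unique : ∀ {a a′ b i j} → Arc a b i → Arc a′ b j → a ≡ a′) where

  Link : A → A → Set
  Link a b = ∃[ i ] (Arc a b i ⊎ Arc b a i)

  -- After a step down from a to b, a step up could only lead back to a, the unique parent of b.
  -- Hence the walk keeps going down and the depth grows to the end.
  descend : ∀ {a b i} ys {p z} → Arc a b i → Linked Link (b ∷ (ys ++ p ∷ z ∷ [])) →
            NonBacktracking (a ∷ b ∷ (ys ++ p ∷ z ∷ [])) → ∃[ j ] (Arc p z j × i < j)
  descend []       arc ((_ , inj₂ up) ∷ _) (a≢p , _) = contradiction (parent-unique arc up) a≢p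
  descend []       arc ((_ , inj₁ down) ∷ (_ , inj₂ up) ∷ _) (_ , b≢z , _) = contradiction (parent-unique down up) b≢z
  descend []       arc ((j , inj₁ down) ∷ (j′ , inj₁ last) ∷ _) _ =
    j′ , last , subst (_ <_) (depth-unique (target down) (source last))
                 (m≤n⇒m≤1+n (≤-reflexive (depth-unique (target arc) (source down))))
  descend (c ∷ ys) arc ((_ , inj₂ up) ∷ _) (a≢c , _) = contradiction (parent-unique arc up) a≢c
  descend (c ∷ ys) arc ((j , inj₁ down) ∷ links) (_ , nb) =
    let j′ , last , j<j′ = descend ys down links nb
    in j′ , last , <-trans (≤-reflexive (depth-unique (target arc) (source down))) j<j′

  -- Such a walk either turns once and then descends to its end, or climbs all the way to p. The
  -- depth is compared at p because p is the starting vertex of the cycle and the last link repeats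
  -- the initial one.
  ascend : ∀ {a} b ys {p z} → Linked Link (a ∷ b ∷ (ys ++ p ∷ z ∷ [])) →
           NonBacktracking (a ∷ b ∷ (ys ++ p ∷ z ∷ [])) →
           (∃[ j ] Arc p z j) ⊎ (∃[ i ] ∃[ j ] (Depth a i × Depth p j × j < i))
  ascend b ys ((i , inj₁ down) ∷ links) nb = let j , last , _ = descend ys down links nb in inj₁ (j , last)
  ascend b [] ((i , inj₂ up) ∷ (j , inj₁ down) ∷ (j′ , inj₁ last) ∷ _) nb = inj₁ (j′ , last)
  ascend b [] ((i , inj₂ up) ∷ (j , inj₁ down) ∷ (j′ , inj₂ last) ∷ _) (_ , b≢z , _) =
    contradiction (parent-unique down last) b≢z
  ascend b [] ((i , inj₂ up) ∷ (j , inj₂ up′) ∷ _) nb =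
    inj₂ (suc i , j , target up , source up′ , s≤s (<⇒≤ (≤-reflexive (depth-unique (target up′) (source up)))))
  ascend b (c ∷ ys) ((i , inj₂ up) ∷ links) (_ , nb) with ascend c ys links nb
  ... | inj₁ last = inj₁ last
  ... | inj₂ (i′ , j , b-depth , p-depth , j<i′) =
    inj₂ (suc i , j , target up , p-depth , m≤n⇒m≤1+n (subst (j <_) (depth-unique b-depth (source up)) j<i′))

  no-cycle : ∀ x xs → 3 ≤ length (x ∷ xs) → Unique (x ∷ xs) → Linked Link ((x ∷ xs) ∷ʳ x) → ⊥
  no-cycle x (y ∷ [])     (s≤s (s≤s ()))
  no-cycle x (y ∷ z ∷ zs) _ ((x≢y ∷ x≢z ∷ x≢zs) ∷ unique@(y≢zzs ∷ _)) links@(first ∷ _) = absurd first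
    where
    walk : Linked Link (x ∷ y ∷ ((z ∷ zs) ++ x ∷ y ∷ []))
    walk = linked-wrap (x ∷ y ∷ z ∷ zs) links first
    nb : NonBacktracking (x ∷ y ∷ ((z ∷ zs) ++ x ∷ y ∷ []))
    nb = x≢z , nonBacktracking-wrap y z zs unique (All.map (_∘ sym) (x≢y ∷ x≢z ∷ x≢zs)) (All.map (_∘ sym) y≢zzs)
    absurd : Link x y → ⊥
    absurd (i , inj₁ down) =
      let j , last , i<j = descend (z ∷ zs) down (Linked.tail walk) nb
      in <-irrefl (depth-unique (source down) (source last)) i<j
    absurd (i , inj₂ up) with ascend y (z ∷ zs) walk nb
    ... | inj₁ (j , last) = <-irrefl (depth-unique (source up) (target last))
      (subst (λ d → i < suc d) (depth-unique (target up) (source last)) (m≤n⇒m≤1+n ≤-refl))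
    ... | inj₂ (_ , _ , x-depth , x-depth′ , j<i) = <-irrefl (depth-unique x-depth′ x-depth) j<i

-- The edge set of a spanning forest as a matching.

module Conversion {m n : ℕ} (G : BipartiteGraph m n) (h′ k : ℕ) where
  open Exploration G h′ k public

  child : Edge → Vertex m n
  child (_ , b , _) = b

  place : Edge → Vertex m n × ℕ
  place (_ , b , i) = b , suc i

  weight-childᴸ : ∀ f i {v} (l : Limbs v) → weight (f ∘ child) (edgesᴸ i l) ≡ wtᴸ f l
  weight-childᵀ : ∀ f i {u j} (ts : Twigs u j) → weight (f ∘ child) (edgesᵀ i ts) ≡ wtᵀ f ts
  weight-childᴸ f i []              = refl
  weight-childᴸ f i (limb u _ ts l) = cong (_+_ (f (inj₁ u)))
    (trans (weight-++ (f ∘ child) (edgesᵀ (suc i) ts) (edgesᴸ i l))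
           (cong₂ _+_ (weight-childᵀ f (suc i) ts) (weight-childᴸ f i l)))
  weight-childᵀ f i []              = refl
  weight-childᵀ f i (twig v _ l ts) =
    trans (cong (_+_ (f (inj₂ v)))
                (trans (weight-++ (f ∘ child) (edgesᴸ (suc i) l) (edgesᵀ i ts))
                       (cong₂ _+_ (weight-childᴸ f (suc i) l) (weight-childᵀ f i ts))))
          (sym (+-assoc (f (inj₂ v)) _ _))

  -- The upper end of an edge is the root or the lower end of the edge above it, so the depth stored
  -- with an edge agrees with the depth listed for its upper end.
  sourceᴸ : ∀ i {v} (l : Limbs v) {a b j} → (a , b , j) ∈ˡ edgesᴸ i l →
            (a , j) ∈ˡ (inj₂ v , i) ∷ map place (edgesᴸ i l)
  sourceᵀ : ∀ i {u j} (ts : Twigs u j) {a b j} → (a , b , j) ∈ˡ edgesᵀ i ts →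
            (a , j) ∈ˡ (inj₁ u , i) ∷ map place (edgesᵀ i ts)
  sourceᴸ i (limb u e ts l) (here refl) = here refl
  sourceᴸ i (limb u e ts l) (there p)
    rewrite map-++ place (edgesᵀ (suc i) ts) (edgesᴸ i l) with ∈-++⁻ (edgesᵀ (suc i) ts) p
  ... | inj₁ q = there (∈-++⁺ˡ (sourceᵀ (suc i) ts q))
  ... | inj₂ q with sourceᴸ i l q
  ...   | here eq  = here eq
  ...   | there r  = there (there (∈-++⁺ʳ (map place (edgesᵀ (suc i) ts)) r))
  sourceᵀ i (twig v e l ts) (here refl) = here refl
  sourceᵀ i (twig v e l ts) (there p)
    rewrite map-++ place (edgesᴸ (suc i) l) (edgesᵀ i ts) with ∈-++⁻ (edgesᴸ (suc i) l) p
  ... | inj₁ q = there (∈-++⁺ˡ (sourceᴸ (suc i) l q))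
  ... | inj₂ q with sourceᵀ i ts q
  ...   | here eq  = here eq
  ...   | there r  = there (there (∈-++⁺ʳ (map place (edgesᴸ (suc i) l)) r))

  incidence : Fin m → Edge → ℕ
  incidence u (a , b , _) = δ (inj₁ u) a + δ (inj₁ u) b

  incidenceᴸ : ∀ u i {v} (l : Limbs v) → weight (incidence u) (edgesᴸ i l) ≡ suc h′ * wtᴸ (δ (inj₁ u)) l
  incidenceᵀ : ∀ u i {w j} (ts : Twigs w j) →
               weight (incidence u) (edgesᵀ i ts) ≡ j * δ (inj₁ u) (inj₁ w) + suc h′ * wtᵀ (δ (inj₁ u)) ts
  incidenceᴸ u i []              = sym (*-zeroʳ (suc h′))
  incidenceᴸ u i (limb w _ ts l) =
    trans (cong (_+_ (δ (inj₁ u) (inj₁ w)))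
                (trans (weight-++ (incidence u) (edgesᵀ (suc i) ts) (edgesᴸ i l))
                       (cong₂ _+_ (incidenceᵀ u (suc i) ts) (incidenceᴸ u i l))))
          (rearrange (δ (inj₁ u) (inj₁ w)) h′ (wtᵀ (δ (inj₁ u)) ts) (wtᴸ (δ (inj₁ u)) l))
    where
    rearrange : ∀ a h b c → a + (h * a + (1 + h) * b + (1 + h) * c) ≡ (1 + h) * (a + (b + c))
    rearrange = solve-∀
  incidenceᵀ u i []                    = sym (*-zeroʳ (suc h′))
  incidenceᵀ u i {w} (twig {j} v _ l ts) =
    trans (cong (_+_ (δ (inj₁ u) (inj₁ w) + 0))
                (trans (weight-++ (incidence u) (edgesᴸ (suc i) l) (edgesᵀ i ts))
                       (cong₂ _+_ (incidenceᴸ u (suc i) l) (incidenceᵀ u i ts))))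
          (rearrange (δ (inj₁ u) (inj₁ w)) (suc h′) (wtᴸ (δ (inj₁ u)) l) j (wtᵀ (δ (inj₁ u)) ts))
    where
    rearrange : ∀ a h b j c → a + 0 + (h * b + (j * a + h * c)) ≡ (1 + j) * a + h * (0 + b + c)
    rearrange = solve-∀

  module _ (Φ : Forest) (spans : Spanning (allFin m) Φ) where

    fits : All Fits Φ
    fits = proj₁ spans

    wt≡total : ∀ f → wtᶠ f Φ ≡ total (allFin m) f
    wt≡total = proj₂ spans

    δ-sym : ∀ x y → δ x y ≡ δ y x
    δ-sym x y with x ≟ᵛ y
    ... | yes x≡y = sym (indicator-yes (y ≟ᵛ x) (sym x≡y))
    ... | no  x≢y = sym (indicator-no (y ≟ᵛ x) (x≢y ∘ sym))

    occurs≤1 : ∀ x → wtᶠ (δ x) Φ ≤ 1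
    occurs≤1 (inj₁ u) = begin
      wtᶠ (δ (inj₁ u)) Φ                    ≡⟨ wt≡total (δ (inj₁ u)) ⟩
      ∑ {n} (λ _ → 0) + weight (λ x → indicator (u ≟ x)) (allFin m)
        ≡⟨ cong (_+ weight (λ x → indicator (u ≟ x)) (allFin m)) (trans (∑-const n 0) (*-zeroʳ n)) ⟩
      weight (λ x → indicator (u ≟ x)) (allFin m) ≤⟨ unique-count u (allFin⁺ m) ⟩
      1                                     ∎
      where open ≤-Reasoning
    occurs≤1 (inj₂ v) = ≤-reflexive (trans (wt≡total (δ (inj₂ v))) (cong₂ _+_
      (trans (sum-cong-≗ (λ w → δ-sym (inj₂ v) (inj₂ w))) (∑-indicator v)) (weight-zero (allFin m))))

    occurs≥1 : ∀ x → 1 ≤ wtᶠ (δ x) Φ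
    occurs≥1 x rewrite wt≡total (δ x) with x
    ... | inj₁ u = ≤-trans (≤-reflexive (sym (δ-refl (inj₁ u))))
                     (≤-trans (weight-∈ (λ x → δ (inj₁ u) (inj₁ x)) (∈-allFin u)) (m≤n+m _ (∑ {n} (λ _ → 0))))
    ... | inj₂ v = ≤-trans (≤-reflexive (sym (δ-refl (inj₂ v))))
                     (≤-trans (term≤∑ (λ w → δ (inj₂ v) (inj₂ w)) v) (m≤m+n _ _))

    treeEdges : Tree → List Edge
    treeEdges (_ , l) = edgesᴸ 0 l

    treePlaces : Tree → List (Vertex m n × ℕ)
    treePlaces t = (inj₂ (proj₁ t) , 0) ∷ map place (treeEdges t)

    edges : List Edge
    edges = concatMap treeEdges Φ

    places : List (Vertex m n × ℕ)
    places = concatMap treePlaces Φ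

    weight-concatMap : ∀ {B : Set} (f : B → ℕ) (g : Tree → List B) Ψ →
                       weight f (concatMap g Ψ) ≡ weight (λ t → weight f (g t)) Ψ
    weight-concatMap f g []      = refl
    weight-concatMap f g (t ∷ Ψ) =
      trans (weight-++ f (g t) (concatMap g Ψ)) (cong (_+_ (weight f (g t))) (weight-concatMap f g Ψ))

    weight-places : ∀ f t → weight (f ∘ proj₁) (treePlaces t) ≡ wt f t
    weight-places f (v , l) = cong (_+_ (f (inj₂ v))) (trans (weight-map (edgesᴸ 0 l)) (weight-childᴸ f 0 l))
      where
      weight-map : ∀ es → weight (f ∘ proj₁) (map place es) ≡ weight (f ∘ child) es
      weight-map []       = refl
      weight-map (e ∷ es) = cong (_+_ (f (child e))) (weight-map es)

    place∈ : ∀ {a b i} t → (a , b , i) ∈ˡ treeEdges t → (b , suc i) ∈ˡ treePlaces t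
    place∈ t e = there (∈-map⁺ place e)

    source∈ : ∀ {a b i} t → (a , b , i) ∈ˡ treeEdges t → (a , i) ∈ˡ treePlaces t
    source∈ (v , l) e = sourceᴸ 0 l e

    place⇒occurs : ∀ {a i} t → (a , i) ∈ˡ treePlaces t → 1 ≤ wt (δ a) t
    place⇒occurs {a} t p = ≤-trans (≤-reflexive (sym (δ-refl a)))
      (≤-trans (weight-∈ (δ a ∘ proj₁) p) (≤-reflexive (weight-places (δ a) t)))

    Arc : Vertex m n → Vertex m n → ℕ → Set
    Arc a b i = (a , b , i) ∈ˡ edges

    Depth : Vertex m n → ℕ → Set
    Depth a i = (a , i) ∈ˡ places

    arc-tree : ∀ {a b i} → Arc a b i → ∃[ t ] (t ∈ˡ Φ × (a , b , i) ∈ˡ treeEdges t)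
    arc-tree arc = find (∈-concatMap⁻ treeEdges {xs = Φ} arc)

    arc-source : ∀ {a b i} → Arc a b i → Depth a i
    arc-source arc = let t , t∈Φ , e = arc-tree arc in ∈-concatMap⁺ treePlaces (lose t∈Φ (source∈ t e))

    arc-target : ∀ {a b i} → Arc a b i → Depth b (suc i)
    arc-target arc = let t , t∈Φ , e = arc-tree arc in ∈-concatMap⁺ treePlaces (lose t∈Φ (place∈ t e))

    depth-unique : ∀ {a i j} → Depth a i → Depth a j → i ≡ j
    depth-unique {a} p q = cong proj₂ (weight-unique (δ a ∘ proj₁) bound p q
      (≤-reflexive (sym (δ-refl a))) (≤-reflexive (sym (δ-refl a))))
      where
      bound : weight (δ a ∘ proj₁) places ≤ 1
      bound = ≤-trans (≤-reflexive (trans (weight-concatMap (δ a ∘ proj₁) treePlaces Φ)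
                                          (weight-cong (weight-places (δ a)) Φ)))
                      (occurs≤1 a)

    parent-unique : ∀ {a a′ b i j} → Arc a b i → Arc a′ b j → a ≡ a′
    parent-unique {b = b} p q = cong proj₁ (weight-unique (δ b ∘ child) bound p q
      (≤-reflexive (sym (δ-refl b))) (≤-reflexive (sym (δ-refl b))))
      where
      bound : weight (δ b ∘ child) edges ≤ 1
      bound = ≤-trans (≤-reflexive (weight-concatMap (δ b ∘ child) treeEdges Φ))
        (≤-trans (weight-mono (λ t → ≤-trans (≤-reflexive (weight-childᴸ (δ b) 0 (proj₂ t))) (m≤n+m _ _)) Φ) (occurs≤1 b))

    open Descent Arc Depth arc-source arc-target depth-unique parent-unique

    Joins : Fin m → Fin n → Edge → Set
    Joins u v (a , b , _) = (inj₁ u ≡ a × inj₂ v ≡ b) ⊎ (inj₁ u ≡ b × inj₂ v ≡ a)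

    joins? : ∀ u v e → Dec (Joins u v e)
    joins? u v (a , b , _) =
      ((inj₁ u ≟ᵛ a) ×-dec (inj₂ v ≟ᵛ b)) ⊎-dec ((inj₁ u ≟ᵛ b) ×-dec (inj₂ v ≟ᵛ a))

    multiplicity : Fin m → Fin n → ℕ
    multiplicity u v = weight (λ e → indicator (joins? u v e)) edges

    F : BipartiteGraph m n
    F u = Vec.tabulate (λ v → does (1 ≤? multiplicity u v))

    F⁺ : ∀ {u v e} → e ∈ˡ edges → Joins u v e → v ∈ F u
    F⁺ {u} {v} {e} e∈ j = ∈-tabulate⁺ (λ v → 1 ≤? multiplicity u v)
      (≤-trans (≤-reflexive (sym (indicator-yes (joins? u v e) j))) (weight-∈ (λ e → indicator (joins? u v e)) e∈))

    F⁻ : ∀ {u v} → v ∈ F u → ∃[ e ] (e ∈ˡ edges × Joins u v e)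
    F⁻ {u} {v} v∈Fu =
      let e , e∈ , p = weight-positive (λ e → indicator (joins? u v e)) edges
                         (∈-tabulate⁻ (λ v → 1 ≤? multiplicity u v) v∈Fu)
      in e , e∈ , indicator-positive (joins? u v e) p

    F⊆G : ∀ {u v} → v ∈ F u → v ∈ G u
    F⊆G v∈Fu with F⁻ v∈Fu
    ... | (a , b , i) , e∈ , j with arc-tree e∈
    ...   | (r , l) , _ , e∈l with j | edges-soundᴸ 0 l e∈l
    ...     | inj₁ (refl , refl) | adj = adj
    ...     | inj₂ (refl , refl) | adj = adj

    adjacent⇒link : ∀ {x y} → Adjacent F x y → Link x y
    adjacent⇒link {inj₁ u} {inj₂ v} adj with F⁻ adj
    ... | (_ , _ , i) , e∈ , inj₁ (refl , refl) = i , inj₁ e∈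
    ... | (_ , _ , i) , e∈ , inj₂ (refl , refl) = i , inj₂ e∈
    adjacent⇒link {inj₂ v} {inj₁ u} adj with F⁻ adj
    ... | (_ , _ , i) , e∈ , inj₁ (refl , refl) = i , inj₂ e∈
    ... | (_ , _ , i) , e∈ , inj₂ (refl , refl) = i , inj₁ e∈

    degree≤ : ∀ u → ∣ F u ∣ ≤ suc h′
    degree≤ u = begin
      ∣ F u ∣                                       ≡⟨ ∣∣≡∑ (F u) ⟩
      ∑ (λ v → indicator (v ∈? F u))                ≤⟨ ∑-mono (λ v → indicator-mono (v ∈? F u)
                                                         (∈-tabulate⁻ (λ v → 1 ≤? multiplicity u v))) ⟩
      ∑ (multiplicity u)                            ≡⟨ weight-∑ (λ v e → indicator (joins? u v e)) edges ⟨
      weight (λ e → ∑ (λ v → indicator (joins? u v e))) edges ≤⟨ weight-mono per-edge edges ⟩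
      weight (incidence u) edges                    ≡⟨ weight-concatMap (incidence u) treeEdges Φ ⟩
      weight (λ t → weight (incidence u) (treeEdges t)) Φ ≡⟨ weight-cong (λ t → incidenceᴸ u 0 (proj₂ t)) Φ ⟩
      weight (λ t → suc h′ * wtᴸ (δ (inj₁ u)) (proj₂ t)) Φ ≡⟨ weight-* (suc h′) (λ t → wtᴸ (δ (inj₁ u)) (proj₂ t)) Φ ⟩
      suc h′ * wtᶠ (δ (inj₁ u)) Φ                   ≤⟨ *-monoʳ-≤ (suc h′) (occurs≤1 (inj₁ u)) ⟩
      suc h′ * 1                                    ≡⟨ *-identityʳ (suc h′) ⟩
      suc h′                                        ∎
      where
      open ≤-Reasoning
      onRight≤1 : ∀ x → onRight x ≤ 1
      onRight≤1 (inj₁ _) = z≤n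
      onRight≤1 (inj₂ _) = ≤-refl
      ∑-product : ∀ c x → ∑ (λ v → c * δ (inj₂ v) x) ≤ c
      ∑-product c x = begin
        ∑ (λ v → c * δ (inj₂ v) x)  ≡⟨ *-distribˡ-sum c (λ v → δ (inj₂ v) x) ⟨
        c * ∑ (λ v → δ (inj₂ v) x)  ≡⟨ cong (_*_ c) (∑-δ-right x) ⟩
        c * onRight x               ≤⟨ *-monoʳ-≤ c (onRight≤1 x) ⟩
        c * 1                       ≡⟨ *-identityʳ c ⟩
        c                           ∎
      product-positive : ∀ x y → 1 ≤ δ x x * δ y y
      product-positive x y = ≤-reflexive (sym (cong₂ _*_ (δ-refl x) (δ-refl y)))
      per-edge : ∀ e → ∑ (λ v → indicator (joins? u v e)) ≤ incidence u e
      per-edge e@(a , b , _) = begin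
        ∑ (λ v → indicator (joins? u v e))
          ≤⟨ ∑-mono (λ v → indicator-mono (joins? u v e) λ
               { (inj₁ (refl , refl)) → ≤-trans (product-positive a b) (m≤m+n _ _)
               ; (inj₂ (refl , refl)) → ≤-trans (product-positive b a) (m≤n+m _ (δ (inj₁ u) a * δ (inj₂ v) b)) }) ⟩
        ∑ (λ v → δ (inj₁ u) a * δ (inj₂ v) b + δ (inj₁ u) b * δ (inj₂ v) a)
          ≡⟨ ∑-distrib-+ (λ v → δ (inj₁ u) a * δ (inj₂ v) b) _ ⟩
        ∑ (λ v → δ (inj₁ u) a * δ (inj₂ v) b) + ∑ (λ v → δ (inj₁ u) b * δ (inj₂ v) a)
          ≤⟨ +-mono-≤ (∑-product (δ (inj₁ u) a) b) (∑-product (δ (inj₁ u) b) a) ⟩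
        incidence u e ∎

    -- In its tree u has h neighbours, all of positive weight under the indicator of `F u`. A
    -- spanning forest counts each right vertex once, so they are distinct and the whole weight is
    -- the size of `F u`.
    degree≥ : ∀ u → suc h′ ≤ ∣ F u ∣
    degree≥ u = begin
      suc h′                          ≤⟨ covered-degreeᴸ u g 0 (proj₂ t) covers in-limbs ⟩
      wt (rightWeight g) t            ≤⟨ weight-∈ (wt (rightWeight g)) t∈Φ ⟩
      wtᶠ (rightWeight g) Φ           ≡⟨ wt≡total (rightWeight g) ⟩
      ∑ g + weight (λ _ → 0) (allFin m) ≡⟨ cong (_+_ (∑ g)) (weight-zero (allFin m)) ⟩
      ∑ g + 0                         ≡⟨ +-identityʳ (∑ g) ⟩
      ∑ g                             ≡⟨ ∣∣≡∑ (F u) ⟨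
      ∣ F u ∣                         ∎
      where
      open ≤-Reasoning
      g : Fin n → ℕ
      g v = indicator (v ∈? F u)
      located = weight-positive (wt (δ (inj₁ u))) Φ (occurs≥1 (inj₁ u))
      t : Tree
      t = proj₁ located
      t∈Φ : t ∈ˡ Φ
      t∈Φ = proj₁ (proj₂ located)
      in-limbs : 1 ≤ wtᴸ (δ (inj₁ u)) (proj₂ t)
      in-limbs = proj₂ (proj₂ located)
      in-F : ∀ {v e} → e ∈ˡ treeEdges t → Joins u v e → 1 ≤ g v
      in-F {v} e∈ j = ≤-reflexive (sym (indicator-yes (v ∈? F u) (F⁺ (∈-concatMap⁺ treeEdges (lose t∈Φ e∈)) j)))
      covers : CoversEdges u g (treeEdges t)
      covers (inj₁ e∈) = in-F e∈ (inj₂ (refl , refl))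
      covers (inj₂ e∈) = in-F e∈ (inj₁ (refl , refl))

    -- An edge at x stems from some tree containing x, and there is only one. A component therefore
    -- stays inside the tree of its centre and inherits its bound k.
    same-tree : ∀ {x y t} → t ∈ˡ Φ → 1 ≤ wt (δ x) t → Star (Adjacent F) x y → 1 ≤ wt (δ y) t
    same-tree         t∈Φ occ ε            = occ
    same-tree {x} {t = t} t∈Φ occ (adj ◅ path) = same-tree t∈Φ (step (adjacent⇒link adj)) path
      where
      step : ∀ {y} → Link x y → 1 ≤ wt (δ y) t
      step (i , inj₁ arc) with arc-tree arc
      ... | t′ , t′∈Φ , e with weight-unique (wt (δ x)) (occurs≤1 x) t∈Φ t′∈Φ occ (place⇒occurs t′ (source∈ t′ e))
      ...   | refl = place⇒occurs t (place∈ t e)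
      step (i , inj₂ arc) with arc-tree arc
      ... | t′ , t′∈Φ , e with weight-unique (wt (δ x)) (occurs≤1 x) t∈Φ t′∈Φ occ (place⇒occurs t′ (place∈ t′ e))
      ...   | refl = place⇒occurs t (source∈ t e)

    induced⇒F : ∀ C {u v} → v ∈ induced F C u → v ∈ F u
    induced⇒F (A , B) {u} v∈ with u ∈? A
    ... | yes _ = proj₁ (x∈p∩q⁻ (F u) B v∈)
    ... | no  _ = contradiction v∈ ∉⊥

    F⇒induced : ∀ A B {u v} → u ∈ A → v ∈ B → v ∈ F u → v ∈ induced F (A , B) u
    F⇒induced A B {u} u∈A v∈B v∈Fu with u ∈? A
    ... | yes _   = x∈p∩q⁺ (v∈Fu , v∈B)
    ... | no  u∉A = contradiction u∈A u∉A

    induced-adjacent : ∀ C {x y} → Adjacent (induced F C) x y → Adjacent F x y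
    induced-adjacent C {inj₁ _} {inj₂ _} = induced⇒F C
    induced-adjacent C {inj₂ _} {inj₁ _} = induced⇒F C

    adjacent-induced : ∀ C {x y} → x ∈ᵛ C → y ∈ᵛ C → Adjacent F x y → Adjacent (induced F C) x y
    adjacent-induced (A , B) {inj₁ _} {inj₂ _} x∈ y∈ = F⇒induced A B x∈ y∈
    adjacent-induced (A , B) {inj₂ _} {inj₁ _} x∈ y∈ = F⇒induced A B y∈ x∈

    adjacent-sym : ∀ (H : BipartiteGraph m n) {x y} → Adjacent H x y → Adjacent H y x
    adjacent-sym H {inj₁ _} {inj₂ _} adj = adj
    adjacent-sym H {inj₂ _} {inj₁ _} adj = adj

    module _ (C : VertexSet m n) (component : IsComponent F C) where

      centre : Vertex m n
      centre = proj₁ component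

      reachable : ∀ {y} → y ∈ᵛ C → Star (Adjacent F) centre y
      reachable {y} = Equivalence.to (proj₂ component y)

      member : ∀ {y} → Star (Adjacent F) centre y → y ∈ᵛ C
      member {y} = Equivalence.from (proj₂ component y)

      -- The prefix from the centre witnesses that every vertex met on the path belongs to C.
      path-induced : ∀ {y z} → Star (Adjacent F) centre y → Star (Adjacent F) y z → Star (Adjacent (induced F C)) y z
      path-induced prefix ε            = ε
      path-induced prefix (adj ◅ path) =
        let prefix′ = prefix ◅◅ (adj ◅ ε)
        in adjacent-induced C (member prefix) (member prefix′) adj ◅ path-induced prefix′ path

      tree-component : IsTree C (induced F C)
      tree-component = record
        { nonempty  = centre , member ε
        ; connected = λ x y x∈C y∈C →
            Star.reverse (λ {x} {y} → adjacent-sym (induced F C) {x} {y}) (path-induced ε (reachable x∈C)) ◅◅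
            path-induced ε (reachable y∈C)
        ; acyclic   = λ { (x ∷ xs) (long , unique , links) →
            no-cycle x xs long unique
              (Linked.map (λ {x} {y} adj → adjacent⇒link {x} {y} (induced-adjacent C {x} {y} adj)) links) }
        }

      left-size : ∣ proj₁ C ∣ ≤ k
      left-size = begin
        ∣ proj₁ C ∣                                ≡⟨ ∣∣≡∑ (proj₁ C) ⟩
        ∑ (λ u → indicator (u ∈? proj₁ C))         ≤⟨ ∑-mono (λ u → indicator-mono (u ∈? proj₁ C) (λ u∈ →
                                                        ≤-trans (same-tree t∈Φ occ (reachable {inj₁ u} u∈)) (m≤m+n _ _))) ⟩
        ∑ (λ u → wtᶠ (δ (inj₁ u)) (t ∷ []))        ≡⟨ ∑-wt-left (t ∷ []) ⟩
        size t + 0                                 ≡⟨ +-identityʳ (size t) ⟩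
        size t                                     ≤⟨ All.lookup fits t∈Φ ⟩
        k                                          ∎
        where
        open ≤-Reasoning
        located = weight-positive (wt (δ centre)) Φ (occurs≥1 centre)
        t = proj₁ located
        t∈Φ = proj₁ (proj₂ located)
        occ = proj₂ (proj₂ located)

      edge-count : edgeCount (induced F C) ≤ suc h′ * k
      edge-count = begin
        edgeCount (induced F C)                              ≡⟨ vec-sum (degree (induced F C)) ⟩
        ∑ (degree (induced F C))                             ≤⟨ ∑-mono bound ⟩
        ∑ (λ u → suc h′ * indicator (u ∈? proj₁ C))          ≡⟨ *-distribˡ-sum (suc h′) (λ u → indicator (u ∈? proj₁ C)) ⟨
        suc h′ * ∑ (λ u → indicator (u ∈? proj₁ C))          ≡⟨ cong (_*_ (suc h′)) (∣∣≡∑ (proj₁ C)) ⟨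
        suc h′ * ∣ proj₁ C ∣                                 ≤⟨ *-monoʳ-≤ (suc h′) left-size ⟩
        suc h′ * k                                           ∎
        where
        open ≤-Reasoning
        vec-sum : ∀ {j} (f : Fin j → ℕ) → Vec.sum (Vec.tabulate f) ≡ ∑ f
        vec-sum {zero}  f = refl
        vec-sum {suc j} f = cong (_+_ (f zero)) (vec-sum (f ∘ suc))
        bound : ∀ u → degree (induced F C) u ≤ suc h′ * indicator (u ∈? proj₁ C)
        bound u with u ∈? proj₁ C
        ... | yes _ = ≤-trans (∣p∩q∣≤∣p∣ (F u) (proj₂ C)) (≤-trans (degree≤ u) (≤-reflexive (sym (*-identityʳ (suc h′)))))
        ... | no  _ = ≤-trans (≤-reflexive (∣⊥∣≡0 n)) z≤n

    spanning⇒matching : HasMatching (suc h′) (suc h′ * k) G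
    spanning⇒matching = F , record
      { F⊆E             = λ u → F⊆G
      ; components-tree = tree-component
      ; components-size = edge-count
      ; left-degree     = λ u → ≤-antisym (degree≤ u) (degree≥ u)
      }

-- Clearing denominators, properties of the ceiling, and the conclusion.

expansion-bound : ∀ a b c s g → fromℕ g ℚᵘ.≥ (fromℕ a ℚᵘ.+ (+ b ℚᵘ./ suc c)) ℚᵘ.* fromℕ s →
                  (suc c * a + b) * s ≤ suc c * g
expansion-bound a b c s g bound = begin
  (suc c * a + b) * s             ≡⟨ rearrange₁ a b (suc c) s ⟩
  -- The products with 1 are the denominators of the images of natural numbers, which unnormalised
  -- arithmetic keeps.
  (a * suc c + b * 1) * s * 1     ≤⟨ ℤ.drop‿+≤+ (subst₂ ℤ._≤_ left right (drop-*≤* bound)) ⟩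
  g * (1 * suc c * 1)             ≡⟨ rearrange₂ g (suc c) ⟩
  suc c * g                       ∎
  where
  open ≤-Reasoning
  rearrange₁ : ∀ a b c s → (c * a + b) * s ≡ (a * c + b * 1) * s * 1
  rearrange₁ = solve-∀
  rearrange₂ : ∀ g c → g * (1 * c * 1) ≡ c * g
  rearrange₂ = solve-∀
  left : (+ a ℤ.* + suc c ℤ.+ + b ℤ.* + 1) ℤ.* + s ℤ.* + 1 ≡ + ((a * suc c + b * 1) * s * 1)
  left = sym (trans (ℤ.pos-* ((a * suc c + b * 1) * s) 1) (cong (ℤ._* + 1)
    (trans (ℤ.pos-* (a * suc c + b * 1) s) (cong (ℤ._* + s)
    (trans (ℤ.pos-+ (a * suc c) (b * 1)) (cong₂ ℤ._+_ (ℤ.pos-* a (suc c)) (ℤ.pos-* b 1)))))))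
  right : + g ℤ.* + (1 * suc c * 1) ≡ + (g * (1 * suc c * 1))
  right = sym (ℤ.pos-* g (1 * suc c * 1))

-- The ceiling is minus the floor of the negated fraction, and integer division of a negative number
-- branches on whether the remainder vanishes.
ceiling-cases : ∀ k h → (suc k ≡ ⌈ suc k ÷ suc h ⌉ * suc h) ⊎
                        (∃[ x ] (⌈ suc k ÷ suc h ⌉ ≡ suc x × x * suc h < suc k))
ceiling-cases k h with suc k ℕ.% suc h in remainder
... | zero  = inj₁ (trans (m≡m%n+[m/n]*n (suc k) (suc h))
    (cong₂ (λ r x → r + x * suc h) remainder (sym (cong ℤ.∣_∣
      (trans (cong ℤ.-_ (ℤ.*-identityˡ _)) (ℤ.neg-involutive (+ (suc k ℕ./ suc h))))))))
... | suc r = inj₂ (suc k ℕ./ suc h , cong (λ i → ℤ.∣ ℤ.- i ∣) (ℤ.*-identityˡ ℤ.-[1+ suc k ℕ./ suc h ]) , (begin-strict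
    suc k ℕ./ suc h * suc h                        <⟨ m<n+m _ (s≤s z≤n) ⟩
    suc r + suc k ℕ./ suc h * suc h                ≡⟨ cong (_+ suc k ℕ./ suc h * suc h) remainder ⟨
    suc k ℕ.% suc h + suc k ℕ./ suc h * suc h      ≡⟨ m≡m%n+[m/n]*n (suc k) (suc h) ⟨
    suc k                                          ∎))
  where open ≤-Reasoning

ceiling-least : ∀ k h w → suc k ≤ suc h * w → ⌈ suc k ÷ suc h ⌉ ≤ w
ceiling-least k h w k≤hw with ceiling-cases k h
... | inj₁ exact = *-cancelʳ-≤ _ w (suc h)
  (≤-trans (≤-reflexive (sym exact)) (≤-trans k≤hw (≤-reflexive (*-comm (suc h) w))))
... | inj₂ (x , eq , lt) = ≤-trans (≤-reflexive eq)
  (*-cancelʳ-< (suc h) x w (<-≤-trans lt (≤-trans k≤hw (≤-reflexive (*-comm (suc h) w)))))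

ceiling-positive : ∀ k h → 1 ≤ ⌈ suc k ÷ suc h ⌉
ceiling-positive k h with ceiling-cases k h
... | inj₁ exact      = n≢0⇒n>0 λ q≡0 → 1+n≢0 (trans exact (cong (_* suc h) q≡0))
... | inj₂ (x , eq , _) = ≤-trans (s≤s z≤n) (≤-reflexive (sym eq))

ceiling-half : ∀ k h → ⌈ suc k ÷ suc (suc h) ⌉ + ⌈ suc k ÷ suc (suc h) ⌉ ≤ suc (suc k)
ceiling-half k h = ≤-trans (+-mono-≤ q≤half q≤half) (begin
  -- By definition `half` is also `⌊ suc (suc k) /2⌋`.
  half + half                    ≤⟨ +-monoʳ-≤ half (⌊n/2⌋≤⌈n/2⌉ (suc (suc k))) ⟩
  half + ⌈ suc (suc k) /2⌉       ≡⟨ ⌊n/2⌋+⌈n/2⌉≡n (suc (suc k)) ⟩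
  suc (suc k)                    ∎)
  where
  open ≤-Reasoning
  half = ⌈ suc k /2⌉
  q≤half : ⌈ suc k ÷ suc (suc h) ⌉ ≤ half
  q≤half = ceiling-least k (suc h) half (begin
    suc k                        ≡⟨ ⌊n/2⌋+⌈n/2⌉≡n (suc k) ⟨
    ⌊ suc k /2⌋ + half           ≤⟨ +-monoˡ-≤ half (⌊n/2⌋≤⌈n/2⌉ (suc k)) ⟩
    half + half                  ≤⟨ +-monoʳ-≤ half (m≤m+n half (h * half)) ⟩
    suc (suc h) * half           ∎)

theorem1p4 : ∀ (k d h : ℕ) .{{_ : NonZero h}} → k ≥ 1 → h < d → h ≥ 2 →
    ∀ (m n : ℕ) (G : BipartiteGraph m n) →
    (∀ (u : Fin m) → degree G u ≤ d) →
    (∀ (S : Subset m) → fromℕ ∣ Γ G S ∣ ℚᵘ.≥ expansion k d h ℚᵘ.* fromℕ ∣ S ∣) →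
    HasMatching h (h * k) G
theorem1p4 (suc k) d (suc zero)    _ _   (s≤s ())
theorem1p4 (suc k) d (suc (suc h)) _ h<d _ m n G degree≤d expands with m≤n⇒∃[o]m+o≡n h<d
... | D′ , refl = spanning⇒matching (proj₁ spanned) (proj₂ spanned)
  where
  open Conversion G (suc h) (suc k)
  q = ⌈ suc k ÷ suc (suc h) ⌉
  d∸h : suc (suc (suc h)) + D′ ∸ suc (suc h) ≡ suc D′
  d∸h = trans (cong (_∸ h) (sym (+-suc h D′))) (m+n∸m≡n h (suc D′))
  expands′ : ∀ S → ((suc (suc k) + D′ * q) * suc h + suc (suc D′)) * ∣ S ∣ ≤ (suc (suc k) + D′ * q) * ∣ Γ G S ∣
  expands′ S = expansion-bound (suc h) (suc (suc D′)) (suc k + D′ * q) ∣ S ∣ ∣ Γ G S ∣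
    -- The inner `subst` writes the numerator as a successor, the outer one replaces d - h by
    -- `suc D′` in numerator and denominator at once.
    (subst (λ x → fromℕ ∣ Γ G S ∣ ℚᵘ.≥
                  (fromℕ (suc h) ℚᵘ.+ + (suc x) ℚᵘ./ (suc (suc k) + (x ∸ 1) * q)) ℚᵘ.* fromℕ ∣ S ∣)
           d∸h
           (subst (λ y → fromℕ ∣ Γ G S ∣ ℚᵘ.≥
                         (fromℕ (suc h) ℚᵘ.+ + y ℚᵘ./ (suc (suc k) + (suc (suc (suc h)) + D′ ∸ suc (suc h) ∸ 1) * q))
                         ℚᵘ.* fromℕ ∣ S ∣)
                  (+-comm (suc (suc (suc h)) + D′ ∸ suc (suc h)) 1)
                  (expands S)))
  open Augmentation G (suc h) (suc k) D′ q
    (ceiling-positive k (suc h)) (ceiling-half k h) (ceiling-least k (suc h))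
    (λ u → ≤-trans (degree≤d u) (≤-reflexive (sym (+-suc (suc (suc h)) D′))))
    expands′ using (spanning)
  spanned : ∃[ Φ ] Spanning (allFin m) Φ
  spanned = spanning (allFin m) (allFin⁺ m)
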